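{- Let $m,\ell\ge 2$ be integers with $\ell\le m$. Then the strict inequalities $$p_{1}(\ell,m) < \cdots < p_{\lfloor \ell m/2\rfloor}(\ell,m) = p_{\lceil \ell m/2\rceil}(\ell,m) > \cdots > p_{\ell m-1}(\ell,m)$$ hold if and only if either $\ell=m=2$, or $\ell,m\ge 5$ and $(\ell,m)$ is not one of $$(5,6),\ (5,10),\ (5,14),\ (6,6),\ (6,7),\ (6,9),\ (6,11),\ (6,13),\ (7,10).$$
   Context: For nonnegative integers $\ell, m$, the numbers $p_n(\ell,m)$ are defined by $$\binom{m+\ell}{m}_q = \frac{(q^{m+1}-1)\cdots(q^{m+\ell}-1)}{(q-1)\cdots(q^{\ell}-1)} = \sum_{n=0}^{\ell m} p_n(\ell,m)\, q^n,$$ so $p_n(\ell,m)$ is the number of partitions of $n$ whose Young diagram fits inside an $\ell\times m$ rectangle. -}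

module Defs where

open import Data.Nat using (_≤ᵇ_; ℕ; zero; suc; _+_; _*_; _∸_; _<_; _≤_; _>_; ⌊_/2⌋; ⌈_/2⌉)
open import Data.Bool using (true; false)
open import Data.Product using (_×_)
open import Relation.Binary.PropositionalEquality using (_≡_)

sumUpTo : ℕ → (ℕ → ℕ) → ℕ
sumUpTo zero    f = f zero
sumUpTo (suc k) f = sumUpTo k f + f (suc k)

-- boxPart ℓ m n = number of partitions of n with at most ℓ parts,
-- each part at most m, i.e. sequences m ≥ a₁ ≥ a₂ ≥ … ≥ a_ℓ ≥ 0 with
-- a₁ + … + a_ℓ = n (Young diagram fits in an ℓ × m rectangle).
-- Enumerated by the value k ≤ m of the largest part a₁.
boxPart : ℕ → ℕ → ℕ → ℕ
boxPart zero    m zero    = 1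
boxPart zero    m (suc n) = 0
boxPart (suc ℓ) m n = sumUpTo m (λ k → step k)
  where
  step : ℕ → ℕ
  step k with k ≤ᵇ n
  ... | true  = boxPart ℓ k (n ∸ k)
  ... | false = 0

p : ℕ → ℕ → ℕ → ℕ
p n ℓ m = boxPart ℓ m n

StrictlyUnimodal : ℕ → ℕ → Set
StrictlyUnimodal ℓ m =
  ((i : ℕ) → 1 ≤ i → i < ⌊ ℓ * m /2⌋ → p i ℓ m < p (suc i) ℓ m)
  × (p ⌊ ℓ * m /2⌋ ℓ m ≡ p ⌈ ℓ * m /2⌉ ℓ m)
  × ((i : ℕ) → ⌈ ℓ * m /2⌉ ≤ i → suc i ≤ ℓ * m ∸ 1 → p i ℓ m > p (suc i) ℓ m)

{-# OPTIONS --safe #-}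
module Submission where

-- The coefficient pₙ(ℓ,m) counts the monomials of degree m and weight n in variables x₀, …, x_ℓ, where xᵢ has weight i,
-- i.e. it is the dimension of a weight space of Symᵐ of the (ℓ+1)-dimensional irreducible sl₂-module.  The lowering
-- operator D = Σ xᵢ ∂/∂xᵢ₊₁ sends weight n to weight n - 1, and below the middle the sl₂-relations make it surjective,
-- so there pₙ₋₁ < pₙ holds if and only if D annihilates a nonzero polynomial of degree m and weight n.  As D is a derivation
-- of an integral domain, such polynomials can be multiplied: strict ascents at (ℓ,m,n) and (ℓ,m′,n′) produce one at
-- (ℓ,m+m′,n+n′).  With m′ = 8 this reduces the positive cases to finitely many rectangles, by means of the symmetry
-- between ℓ and m.  For ℓ = 2, 3, 4 the differences pₙ - pₙ₋₁ near the middle are computed by induction on m from the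
-- q-Pascal recursion and the symmetry pₙ = p_{ℓm-n}.

open import Defs
open import Data.Bool using (true; false; T)
open import Data.Empty using (⊥-elim)
open import Data.Nat
open import Data.Integer as ℤ using (ℤ; 0ℤ; 1ℤ; +_)
import Data.Integer.Properties as ℤₚ
import Data.Integer.Tactic.RingSolver as ℤSolver
open import Data.List as List using (List; []; _∷_; _++_; length)
open import Data.List.Membership.DecPropositional _≟_ using (_∈?_)
open import Data.List.Membership.Propositional using (_∈_; _∉_)
open import Data.List.Membership.Propositional.Properties using (∈-map⁺; ∈-map⁻; ∈-++⁺ˡ; ∈-++⁺ʳ)
open import Data.List.Properties using (length-++; length-map)
open import Data.List.Relation.Unary.All as All using (All; []; _∷_)
import Data.List.Relation.Unary.All.Properties as Allₚ
open import Data.List.Relation.Unary.AllPairs using ([]; _∷_)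
open import Data.List.Relation.Unary.Any using (here; there)
open import Data.List.Relation.Unary.Unique.Propositional using (Unique)
import Data.List.Relation.Unary.Unique.Propositional.Properties as Uniqueₚ
open import Data.Nat.Induction using (<-rec)
open import Data.Nat.Properties
import Data.Nat.Tactic.RingSolver as ℕSolver
open import Data.Product using (Σ-syntax; _×_; _,_; proj₁; proj₂)
open import Data.Sum using (_⊎_; inj₁; inj₂; [_,_]′)
open import Data.Unit using (⊤; tt)
open import Data.Vec as Vec using (Vec; []; _∷_)
import Data.Vec.Properties as Vecₚ
open import Data.Vec.Relation.Unary.Any using (Any; here; there)
open import Function using (_∘_; case_of_)
open import Function.Bundles using (_⇔_; mk⇔)
open import Relation.Binary.Definitions using (DecidableEquality)
open import Relation.Binary.PropositionalEquality
open import Relation.Nullary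
open import Relation.Nullary.Decidable using (toWitness; toWitnessFalse; False; _→-dec_; _×-dec_; ¬?)

-- Why 8: a weight n ≤ ℓ(m + m′)/2 has to be split into weights from the lower halves for m and for
-- m′. If ℓm and ℓm′ are both odd, each half loses 1/2 to rounding and the middle weight is out of
-- reach; so m′ must be even in order to serve odd ℓ. Since ℓ = 2 and ℓ = 4 fail and (5,6) is
-- exceptional, 8 is the least even m′ for which (ℓ,m′) ascends throughout for every ℓ ≥ 5.
--
-- Surjectivity of D is never proved as such. Below the middle the raising operator maps weight n -
-- 1 injectively into weight n, and its image meets the kernel of D only in 0; hence a single kernel
-- element forces pₙ₋₁ < pₙ. All of this takes place over ℤ, and both implications rest on one fact:
-- a homogeneous system with fewer equations than unknowns has a nonzero solution.

-- The two q-Pascal rules and the symmetries of Gaussian coefficients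

-- On coefficient sequences with default 0 this is multiplication by q^s. The default is a parameter
-- because lists of monomials are shifted as well, with default `[]`.
shift : {A : Set} → A → ℕ → (ℕ → A) → ℕ → A
shift z zero    f n       = f n
shift z (suc s) f zero    = z
shift z (suc s) f (suc n) = shift z s f n

-- The number of monomials of degree d and weight n in k variables, split according to divisibility by the first one;
-- pₙ(ℓ,m) is count (suc ℓ) m n.
count : ℕ → ℕ → ℕ → ℕ
count zero    zero    zero    = 1
count zero    zero    (suc n) = 0
count zero    (suc d) n       = 0
count (suc k) zero    n       = count k 0 n
count (suc k) (suc d) n       = count (suc k) d n + shift 0 (suc d) (count k (suc d)) n

shift-cong : ∀ {A : Set} {z : A} s {f g : ℕ → A} → (∀ n → f n ≡ g n) → ∀ n → shift z s f n ≡ shift z s g n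
shift-cong zero    h n       = h n
shift-cong (suc s) h zero    = refl
shift-cong (suc s) h (suc n) = shift-cong s h n

shift-zero : ∀ s n → shift 0 s (λ _ → 0) n ≡ 0
shift-zero zero    n       = refl
shift-zero (suc s) zero    = refl
shift-zero (suc s) (suc n) = shift-zero s n

shift-+ : ∀ s (f g : ℕ → ℕ) n → shift 0 s (λ n → f n + g n) n ≡ shift 0 s f n + shift 0 s g n
shift-+ zero    f g n       = refl
shift-+ (suc s) f g zero    = refl
shift-+ (suc s) f g (suc n) = shift-+ s f g n

shift-shift : ∀ {A : Set} {z : A} s t (f : ℕ → A) n → shift z s (shift z t f) n ≡ shift z (s + t) f n
shift-shift zero    t f n       = refl
shift-shift (suc s) t f zero    = refl
shift-shift (suc s) t f (suc n) = shift-shift s t f n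

shift-∘ : ∀ {A B : Set} {z : A} (h : A → B) s (f : ℕ → A) n → h (shift z s f n) ≡ shift (h z) s (λ n → h (f n)) n
shift-∘ h zero    f n       = refl
shift-∘ h (suc s) f zero    = refl
shift-∘ h (suc s) f (suc n) = shift-∘ h s f n

shift-≥ : ∀ {A : Set} {z : A} s (f : ℕ → A) n → shift z s f (s + n) ≡ f n
shift-≥ zero    f n = refl
shift-≥ (suc s) f n = shift-≥ s f n

shift-< : ∀ {A : Set} {z : A} s (f : ℕ → A) {n} → n < s → shift z s f n ≡ z
shift-< (suc s) f {zero}  n<s       = refl
shift-< (suc s) f {suc n} (s≤s n<s) = shift-< s f n<s

sumUpTo-cong : ∀ m {f g : ℕ → ℕ} → (∀ k → f k ≡ g k) → sumUpTo m f ≡ sumUpTo m g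
sumUpTo-cong zero    h = h 0
sumUpTo-cong (suc m) h = cong₂ _+_ (sumUpTo-cong m h) (h (suc m))

-- Names the function local to boxPart.
boxPart-summand : ∀ ℓ m n → Σ[ f ∈ (ℕ → ℕ) ] boxPart (suc ℓ) m n ≡ sumUpTo m f
boxPart-summand ℓ m n = _ , refl

summand≡shift : ∀ ℓ m n k → proj₁ (boxPart-summand ℓ m n) k ≡ shift 0 k (boxPart ℓ k) n
summand≡shift ℓ m n k with k ≤ᵇ n in eq
... | true  = sym (trans (cong (shift 0 k (boxPart ℓ k)) (sym (m+[n∸m]≡n k≤n))) (shift-≥ k (boxPart ℓ k) (n ∸ k)))
  where k≤n = ≤ᵇ⇒≤ k n (subst T (sym eq) _)
... | false = sym (shift-< k (boxPart ℓ k) (≰⇒> (λ k≤n → subst T eq (≤⇒≤ᵇ k≤n))))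

sumUpTo-shift-count : ∀ ℓ m n → sumUpTo m (λ k → shift 0 k (count ℓ k) n) ≡ count (suc ℓ) m n
sumUpTo-shift-count ℓ zero    n = refl
sumUpTo-shift-count ℓ (suc m) n = cong (_+ shift 0 (suc m) (count ℓ (suc m)) n) (sumUpTo-shift-count ℓ m n)

boxPart-zero : ∀ m n → boxPart 0 m n ≡ count 1 m n
boxPart-zero zero    zero    = refl
boxPart-zero zero    (suc n) = refl
boxPart-zero (suc m) n =
  trans (trans (indep n) (boxPart-zero m n)) (sym (trans (cong (λ z → count 1 m n + z) (shift-zero (suc m) n)) (+-identityʳ _)))
  where
  indep : ∀ n → boxPart 0 (suc m) n ≡ boxPart 0 m n
  indep zero    = refl
  indep (suc n) = refl

boxPart≡count : ∀ ℓ m n → boxPart ℓ m n ≡ count (suc ℓ) m n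
boxPart≡count zero    m n = boxPart-zero m n
boxPart≡count (suc ℓ) m n = begin
  boxPart (suc ℓ) m n                                ≡⟨ proj₂ (boxPart-summand ℓ m n) ⟩
  sumUpTo m (proj₁ (boxPart-summand ℓ m n))          ≡⟨ sumUpTo-cong m (summand≡shift ℓ m n) ⟩
  sumUpTo m (λ k → shift 0 k (boxPart ℓ k) n)        ≡⟨ sumUpTo-cong m (λ k → shift-cong k (boxPart≡count ℓ k) n) ⟩
  sumUpTo m (λ k → shift 0 k (count (suc ℓ) k) n)    ≡⟨ sumUpTo-shift-count (suc ℓ) m n ⟩
  count (suc (suc ℓ)) m n                            ∎
  where open ≡-Reasoning

-- The other q-Pascal rule: it splits by divisibility by the last variable, which has weight `k`.
-- The symmetries below come from playing it off against the defining recursion. By induction, both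
-- sides are expanded by both rules, and the two iterated shifts agree because their exponents have
-- the same sum.
count-lastVariable : ∀ k d n → count (suc k) (suc d) n ≡ count k (suc d) n + shift 0 k (count (suc k) d) n
count-lastVariable zero    d       n = trans (cong (λ z → count 1 d n + z) (shift-zero (suc d) n)) (+-identityʳ _)
count-lastVariable (suc k) zero    n = begin
  count (suc k) 0 n + shift 0 1 (count (suc k) 1) n
    ≡⟨ cong (λ z → count (suc k) 0 n + z) (trans (shift-cong 1 (count-lastVariable k 0) n) (shift-+ 1 (count k 1) _ n)) ⟩
  count (suc k) 0 n + (shift 0 1 (count k 1) n + shift 0 1 (shift 0 k (count (suc k) 0)) n)
    ≡⟨ cong (λ z → count (suc k) 0 n + (shift 0 1 (count k 1) n + z)) (shift-shift 1 k _ n) ⟩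
  count (suc k) 0 n + (shift 0 1 (count k 1) n + shift 0 (suc k) (count (suc k) 0) n)
    ≡⟨ sym (+-assoc (count (suc k) 0 n) _ _) ⟩
  count (suc k) 1 n + shift 0 (suc k) (count (suc k) 0) n ∎
  where open ≡-Reasoning
count-lastVariable (suc k) (suc d) n = begin
  count (2 + k) (1 + d) n + shift 0 (2 + d) (count (1 + k) (2 + d)) n
    ≡⟨ cong₂ _+_ (count-lastVariable (suc k) d n)
        (trans (shift-cong (2 + d) (count-lastVariable k (suc d)) n) (shift-+ (2 + d) (count k (2 + d)) _ n)) ⟩
  (count (1 + k) (1 + d) n + shift 0 (1 + k) (count (2 + k) d) n)
    + (shift 0 (2 + d) (count k (2 + d)) n + shift 0 (2 + d) (shift 0 k (count (1 + k) (1 + d))) n)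
    ≡⟨ cong (λ z → (count (1 + k) (1 + d) n + shift 0 (1 + k) (count (2 + k) d) n) + (shift 0 (2 + d) (count k (2 + d)) n + z)) exchange ⟩
  (count (1 + k) (1 + d) n + shift 0 (1 + k) (count (2 + k) d) n)
    + (shift 0 (2 + d) (count k (2 + d)) n + shift 0 (1 + k) (shift 0 (1 + d) (count (1 + k) (1 + d))) n)
    ≡⟨ interchange (count (1 + k) (1 + d) n) (shift 0 (1 + k) (count (2 + k) d) n) _ _ ⟩
  (count (1 + k) (1 + d) n + shift 0 (2 + d) (count k (2 + d)) n)
    + (shift 0 (1 + k) (count (2 + k) d) n + shift 0 (1 + k) (shift 0 (1 + d) (count (1 + k) (1 + d))) n)
    ≡⟨ cong (λ z → count (1 + k) (2 + d) n + z) (sym (shift-+ (1 + k) (count (2 + k) d) _ n)) ⟩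
  count (1 + k) (2 + d) n + shift 0 (1 + k) (count (2 + k) (1 + d)) n ∎
  where
  open ≡-Reasoning
  interchange : ∀ a b c d → (a + b) + (c + d) ≡ (a + c) + (b + d)
  interchange = ℕSolver.solve-∀
  exponents : ∀ d k → 2 + d + k ≡ 1 + k + (1 + d)
  exponents = ℕSolver.solve-∀
  f = count (1 + k) (1 + d)
  exchange : shift 0 (2 + d) (shift 0 k f) n ≡ shift 0 (1 + k) (shift 0 (1 + d) f) n
  exchange = trans (shift-shift (2 + d) k f n)
    (trans (cong (λ s → shift 0 s f n) (exponents d k)) (sym (shift-shift (1 + k) (1 + d) f n)))

count-zeroDegree : ∀ k n → count k 0 n ≡ count 0 0 n
count-zeroDegree zero    n = refl
count-zeroDegree (suc k) n = count-zeroDegree k n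

count-oneVariable : ∀ d n → count 1 d n ≡ count 0 0 n
count-oneVariable zero    n = refl
count-oneVariable (suc d) n =
  trans (trans (cong (λ z → count 1 d n + z) (shift-zero (suc d) n)) (+-identityʳ _)) (count-oneVariable d n)

-- Conjugation of Young diagrams without a bijection: exchanging ℓ and m exchanges the two q-Pascal
-- rules.
count-transpose : ∀ ℓ m n → count (suc ℓ) m n ≡ count (suc m) ℓ n
count-transpose zero    m       n = trans (count-oneVariable m n) (sym (count-zeroDegree (suc m) n))
count-transpose (suc ℓ) zero    n = trans (count-zeroDegree (2 + ℓ) n) (sym (count-oneVariable (suc ℓ) n))
count-transpose (suc ℓ) (suc m) n = trans
  (cong₂ _+_ (count-transpose (suc ℓ) m n) (shift-cong (suc m) (count-transpose ℓ (suc m)) n))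
  (sym (count-lastVariable (suc m) ℓ n))

count-vanish : ∀ ℓ m n → ℓ * m < n → count (suc ℓ) m n ≡ 0
count-vanish zero    m       (suc n) _ = count-oneVariable m (suc n)
count-vanish (suc ℓ) zero    (suc n) _ = count-zeroDegree (2 + ℓ) (suc n)
count-vanish (suc ℓ) (suc m) n       h = cong₂ _+_
  (count-vanish (suc ℓ) m n (≤-<-trans (*-monoʳ-≤ (suc ℓ) (n≤1+n m)) h))
  (trans (cong (shift 0 (suc m) (count (suc ℓ) (suc m))) (sym (m+[n∸m]≡n m<n)))
    (trans (shift-≥ (suc m) (count (suc ℓ) (suc m)) (n ∸ suc m))
      (count-vanish ℓ (suc m) (n ∸ suc m) (+-cancelˡ-< (suc m) _ _ (subst (suc m + ℓ * suc m <_) (sym (m+[n∸m]≡n m<n)) h)))))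
  where m<n = ≤-trans (m≤m+n (suc m) (ℓ * suc m)) (<⇒≤ h)

-- A palindrome of length `N`, read backwards about (s + N)/2, becomes its own shift. When `b < s`
-- the shift takes its default, and then `a` exceeds `N`, where `f` vanishes too.
reflect-shift : ∀ {N} (f : ℕ → ℕ) → (∀ n → N < n → f n ≡ 0) → (∀ a b → a + b ≡ N → f a ≡ f b) →
  ∀ s a b → a + b ≡ s + N → f a ≡ shift 0 s f b
reflect-shift {N} f vanish symm s a b eq with s ≤? b
... | yes s≤b = trans (symm a (b ∸ s) (+-cancelˡ-≡ s _ _ (begin
    s + (a + (b ∸ s)) ≡⟨ exchange s a (b ∸ s) ⟩
    a + (s + (b ∸ s)) ≡⟨ cong (λ z → a + z) (m+[n∸m]≡n s≤b) ⟩
    a + b             ≡⟨ eq ⟩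
    s + N             ∎)))
  (trans (sym (shift-≥ s f (b ∸ s))) (cong (shift 0 s f) (m+[n∸m]≡n s≤b)))
  where
  open ≡-Reasoning
  exchange : ∀ x y z → x + (y + z) ≡ y + (x + z)
  exchange = ℕSolver.solve-∀
... | no s≰b = trans
  (vanish a (+-cancelˡ-< s _ _ (subst (_< s + a) eq (subst (a + b <_) (+-comm a s) (+-monoʳ-< a (≰⇒> s≰b))))))
  (sym (shift-< s f (≰⇒> s≰b)))

-- Complementation in the rectangle. Reversal turns the first summand of the defining recursion into
-- the second summand of `count-lastVariable`, and the second into the first.
count-reflect : ∀ ℓ m a b → a + b ≡ ℓ * m → count (suc ℓ) m a ≡ count (suc ℓ) m b
count-reflect zero    m       zero zero eq = refl
count-reflect (suc ℓ) zero    a    b    eq = both a b (trans eq (*-zeroʳ (suc ℓ)))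
  where
  both : ∀ a b → a + b ≡ 0 → count (2 + ℓ) 0 a ≡ count (2 + ℓ) 0 b
  both zero zero _ = refl
count-reflect (suc ℓ) (suc m) a    b    eq = begin
  count (2 + ℓ) m a + shift 0 (suc m) (count (suc ℓ) (suc m)) a
    ≡⟨ cong₂ _+_
        (reflect-shift (count (2 + ℓ) m) (count-vanish (suc ℓ) m) (count-reflect (suc ℓ) m) (suc ℓ) a b (trans eq (*-suc (suc ℓ) m)))
        (sym (reflect-shift (count (suc ℓ) (suc m)) (count-vanish ℓ (suc m)) (count-reflect ℓ (suc m)) (suc m) b a (trans (+-comm b a) eq))) ⟩
  shift 0 (suc ℓ) (count (2 + ℓ) m) b + count (suc ℓ) (suc m) b
    ≡⟨ +-comm (shift 0 (suc ℓ) (count (2 + ℓ) m) b) _ ⟩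
  count (suc ℓ) (suc m) b + shift 0 (suc ℓ) (count (2 + ℓ) m) b
    ≡⟨ sym (count-lastVariable (suc ℓ) m b) ⟩
  count (2 + ℓ) (suc m) b ∎
  where open ≡-Reasoning

-- Homogeneous linear systems

combination : ∀ {X : Set} {c} → Vec ℤ c → Vec (X → ℤ) c → X → ℤ
combination []       []       a = 0ℤ
combination (x ∷ xs) (v ∷ vs) a = x ℤ.* v a ℤ.+ combination xs vs a

NonZeroVec : ∀ {c} → Vec ℤ c → Set
NonZeroVec = Any (_≢ 0ℤ)

*-nontrivial : ∀ {a b} → a ≢ 0ℤ → b ≢ 0ℤ → a ℤ.* b ≢ 0ℤ
*-nontrivial {a} a≢0 b≢0 eq = [ a≢0 , b≢0 ]′ (ℤₚ.i*j≡0⇒i≡0∨j≡0 a eq)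

scale-nontrivial : ∀ {a c} {xs : Vec ℤ c} → a ≢ 0ℤ → NonZeroVec xs → NonZeroVec (Vec.map (a ℤ.*_) xs)
scale-nontrivial a≢0 (here x≢0) = here (*-nontrivial a≢0 x≢0)
scale-nontrivial a≢0 (there xs) = there (scale-nontrivial a≢0 xs)

module Elimination {X : Set} (b : X) where

  -- Pivoting without division, so that all coefficients stay integers.
  clear : (X → ℤ) → (X → ℤ) → X → ℤ
  clear v w a = v b ℤ.* w a ℤ.- w b ℤ.* v a

  combination-clear : ∀ v {c} (xs : Vec ℤ c) ws a →
    combination xs (Vec.map (clear v) ws) a ≡
    ℤ.- combination xs ws b ℤ.* v a ℤ.+ combination (Vec.map (v b ℤ.*_) xs) ws a
  combination-clear v []       []       a = refl
  combination-clear v (x ∷ xs) (w ∷ ws) a =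
    trans (cong (λ z → x ℤ.* clear v w a ℤ.+ z) (combination-clear v xs ws a))
      (rearrange x (v b) (w a) (w b) (v a) (combination xs ws b) _)
    where
    rearrange : ∀ x vb wa wb va s t →
      x ℤ.* (vb ℤ.* wa ℤ.- wb ℤ.* va) ℤ.+ (ℤ.- s ℤ.* va ℤ.+ t) ≡
      ℤ.- (x ℤ.* wb ℤ.+ s) ℤ.* va ℤ.+ (vb ℤ.* x ℤ.* wa ℤ.+ t)
    rearrange = ℤSolver.solve-∀

  combination-clear-vanish : ∀ v {c} (xs : Vec ℤ c) ws → combination xs (Vec.map (clear v) ws) b ≡ 0ℤ
  combination-clear-vanish v []       []       = refl
  combination-clear-vanish v (x ∷ xs) (w ∷ ws) =
    trans (cong (λ z → x ℤ.* clear v w b ℤ.+ z) (combination-clear-vanish v xs ws)) (cancel x (v b) (w b))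
    where
    cancel : ∀ x vb wb → x ℤ.* (vb ℤ.* wb ℤ.- wb ℤ.* vb) ℤ.+ 0ℤ ≡ 0ℤ
    cancel = ℤSolver.solve-∀

  -- One equation is traded for one vector. Instead of independence it is enough to remember that
  -- `lift` takes nonzero coefficient vectors to nonzero ones.
  record Reduction {c} (vs : Vec (X → ℤ) (suc c)) : Set where
    field
      reduced   : Vec (X → ℤ) c
      vanish    : ∀ xs → combination xs reduced b ≡ 0ℤ
      lift      : Vec ℤ c → Vec ℤ (suc c)
      lift-≡    : ∀ xs a → combination xs reduced a ≡ combination (lift xs) vs a
      lift-nontrivial : ∀ {xs} → NonZeroVec xs → NonZeroVec (lift xs)

  reduce : ∀ {c} (vs : Vec (X → ℤ) (suc c)) → Reduction vs
  reduce {c} (v ∷ vs) with v b ℤ.≟ 0ℤ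
  ... | no v≢0 = record
    { reduced      = Vec.map (clear v) vs
    ; vanish       = λ xs → combination-clear-vanish v xs vs
    ; lift         = λ xs → ℤ.- combination xs vs b ∷ Vec.map (v b ℤ.*_) xs
    ; lift-≡       = λ xs a → combination-clear v xs vs a
    ; lift-nontrivial = λ nz → there (scale-nontrivial v≢0 nz)
    }
  -- The family must shrink by one, so the only vector is dropped although it already vanishes at
  -- `b`; an empty coefficient vector is never nonzero, so no solution has to be lifted.
  reduce {zero}  (v ∷ []) | yes v≡0 = record
    { reduced      = []
    ; vanish       = λ { [] → refl }
    ; lift         = λ _ → 0ℤ ∷ []
    ; lift-≡       = λ { [] a → refl }
    ; lift-nontrivial = λ ()
    }
  reduce {suc c} (v ∷ vs) | yes v≡0 = record
    { reduced      = v ∷ reduced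
    ; vanish       = λ { (x ∷ xs) → cong₂ ℤ._+_ (trans (cong (x ℤ.*_) v≡0) (ℤₚ.*-zeroʳ x)) (vanish xs) }
    ; lift         = λ { (x ∷ xs) → x ∷ lift xs }
    ; lift-≡       = λ { (x ∷ xs) a → cong (λ z → x ℤ.* v a ℤ.+ z) (lift-≡ xs a) }
    ; lift-nontrivial = λ { {x ∷ xs} (here x≢0) → here x≢0 ; {x ∷ xs} (there nz) → there (lift-nontrivial nz) }
    }
    where open Reduction (reduce vs)

-- Gaussian elimination: every equation costs one vector and at least one vector survives, after
-- which any nonzero coefficients will do.
linearSystem : ∀ {X : Set} {c} (vs : Vec (X → ℤ) c) (bs : List X) → List.length bs < c →
  Σ[ xs ∈ Vec ℤ c ] NonZeroVec xs × All (λ b → combination xs vs b ≡ 0ℤ) bs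
linearSystem {c = suc c} vs []       h = Vec.replicate (suc c) 1ℤ , here (λ ()) , []
linearSystem {c = suc c} vs (b ∷ bs) (s≤s h) =
  let xs , nz , zs = linearSystem reduced bs h in
  lift xs , lift-nontrivial nz ,
  trans (sym (lift-≡ xs b)) (vanish xs) ∷ All.map (λ {a} → trans (sym (lift-≡ xs a))) zs
  where open Elimination.Reduction (Elimination.reduce b vs)

record Linear {X Y : Set} (L : (X → ℤ) → Y → ℤ) : Set where
  field
    preserves-cong : ∀ {f g} → (∀ a → f a ≡ g a) → ∀ a → L f a ≡ L g a
    preserves-0 : ∀ a → L (λ _ → 0ℤ) a ≡ 0ℤ
    preserves-+ : ∀ f g a → L (λ b → f b ℤ.+ g b) a ≡ L f a ℤ.+ L g a
    preserves-* : ∀ x f a → L (λ b → x ℤ.* f b) a ≡ x ℤ.* L f a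

  preserves-combination : ∀ {c} (xs : Vec ℤ c) vs a →
    L (combination xs vs) a ≡ combination xs (Vec.map L vs) a
  preserves-combination []       []       a = preserves-0 a
  preserves-combination (x ∷ xs) (v ∷ vs) a = trans (preserves-+ (λ b → x ℤ.* v b) (combination xs vs) a)
    (cong₂ ℤ._+_ (preserves-* x v a) (preserves-combination xs vs a))

module Indicators {X : Set} (_≟_ : DecidableEquality X) where

  indicator : X → X → ℤ
  indicator a b with a ≟ b
  ... | yes _ = 1ℤ
  ... | no  _ = 0ℤ

  indicator-refl : ∀ a → indicator a a ≡ 1ℤ
  indicator-refl a with a ≟ a
  ... | yes _  = refl
  ... | no a≢a = ⊥-elim (a≢a refl)

  indicator-≢ : ∀ {a b} → a ≢ b → indicator a b ≡ 0ℤ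
  indicator-≢ {a} {b} a≢b with a ≟ b
  ... | yes a≡b = ⊥-elim (a≢b a≡b)
  ... | no _    = refl

  indicators : (as : List X) → Vec (X → ℤ) (List.length as)
  indicators as = Vec.map indicator (Vec.fromList as)

  combination-outside : ∀ {as b} → All (_≢ b) as → ∀ xs → combination xs (indicators as) b ≡ 0ℤ
  combination-outside []          []       = refl
  combination-outside (a≢b ∷ all) (x ∷ xs) =
    cong₂ ℤ._+_ (trans (cong (x ℤ.*_) (indicator-≢ a≢b)) (ℤₚ.*-zeroʳ x)) (combination-outside all xs)

  indicators-independent : ∀ {as} → Unique as → ∀ xs → (∀ b → combination xs (indicators as) b ≡ 0ℤ) → ¬ NonZeroVec xs
  indicators-independent {a ∷ as} (a∉ ∷ unique) (x ∷ xs) zeros = λ where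
      (here x≢0) → x≢0 x≡0
      (there nz) → indicators-independent unique xs zerosTail nz
    where
    outside : combination xs (indicators as) a ≡ 0ℤ
    outside = combination-outside (All.map (λ a≢b b≡a → a≢b (sym b≡a)) a∉) xs
    x≡0 : x ≡ 0ℤ
    x≡0 = begin
      x                                                                    ≡⟨ sym (ℤₚ.+-identityʳ x) ⟩
      x ℤ.+ 0ℤ                                                             ≡⟨ cong₂ ℤ._+_ (sym (ℤₚ.*-identityʳ x)) (sym outside) ⟩
      x ℤ.* 1ℤ ℤ.+ combination xs (indicators as) a                        ≡⟨ cong (λ i → x ℤ.* i ℤ.+ combination xs (indicators as) a) (sym (indicator-refl a)) ⟩
      x ℤ.* indicator a a ℤ.+ combination xs (indicators as) a             ≡⟨ zeros a ⟩
      0ℤ                                                                   ∎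
      where open ≡-Reasoning
    zerosTail : ∀ b → combination xs (indicators as) b ≡ 0ℤ
    zerosTail b = trans (sym (ℤₚ.+-identityˡ _))
      (trans (cong (λ y → y ℤ.* indicator a b ℤ.+ combination xs (indicators as) b) (sym x≡0)) (zeros b))

-- Monomials

Mon : ℕ → Set
Mon = Vec ℕ

degree : ∀ {k} → Mon k → ℕ
degree []      = 0
degree (n ∷ a) = n + degree a

-- The i-th variable, counted from 0, has weight i.
weight : ∀ {k} → Mon k → ℕ
weight []      = 0
weight (n ∷ a) = degree a + weight a

incrementHead : ∀ {k} → Mon (suc k) → Mon (suc k)
incrementHead (n ∷ a) = suc n ∷ a

-- Follows the recursion of `count` clause by clause, so that lengths can be compared by the same
-- recursion.
monomials : ∀ k → ℕ → ℕ → List (Mon k)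
monomials zero    zero    zero    = [] ∷ []
monomials zero    zero    (suc n) = []
monomials zero    (suc d) n       = []
monomials (suc k) zero    n       = List.map (0 ∷_) (monomials k 0 n)
monomials (suc k) (suc d) n       =
  List.map incrementHead (monomials (suc k) d n) ++ List.map (0 ∷_) (shift [] (suc d) (monomials k (suc d)) n)

length-monomials : ∀ k d n → length (monomials k d n) ≡ count k d n
length-monomials zero    zero    zero    = refl
length-monomials zero    zero    (suc n) = refl
length-monomials zero    (suc d) n       = refl
length-monomials (suc k) zero    n       = trans (length-map (0 ∷_) (monomials k 0 n)) (length-monomials k 0 n)
length-monomials (suc k) (suc d) n       = begin
  length (List.map incrementHead (monomials (suc k) d n) ++ List.map (0 ∷_) (shift [] (suc d) (monomials k (suc d)) n))
    ≡⟨ length-++ (List.map incrementHead (monomials (suc k) d n)) ⟩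
  length (List.map incrementHead (monomials (suc k) d n)) + length (List.map (0 ∷_) (shift [] (suc d) (monomials k (suc d)) n))
    ≡⟨ cong₂ _+_ (trans (length-map incrementHead (monomials (suc k) d n)) (length-monomials (suc k) d n))
        (trans (length-map (0 ∷_) (shift [] (suc d) (monomials k (suc d)) n))
          (trans (shift-∘ length (suc d) (monomials k (suc d)) n) (shift-cong (suc d) (length-monomials k (suc d)) n))) ⟩
  count (suc k) (suc d) n ∎
  where open ≡-Reasoning

Of : ∀ {k} → ℕ → ℕ → Mon k → Set
Of d n a = degree a ≡ d × weight a ≡ n

shift-elim : ∀ {A : Set} {z : A} (P : ℕ → A → Set) s {f : ℕ → A} →
  (∀ n → n < s → P n z) → (∀ n → P (s + n) (f n)) → ∀ n → P n (shift z s f n)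
shift-elim P zero    hz hf n       = hf n
shift-elim P (suc s) hz hf zero    = hz 0 (s≤s z≤n)
shift-elim P (suc s) hz hf (suc n) = shift-elim (P ∘ suc) s (λ n h → hz (suc n) (s≤s h)) hf n

monomials-sound : ∀ k d n → All (Of d n) (monomials k d n)
monomials-sound zero    zero    zero    = (refl , refl) ∷ []
monomials-sound zero    zero    (suc n) = []
monomials-sound zero    (suc d) n       = []
monomials-sound (suc k) zero    n       =
  Allₚ.map⁺ (All.map (λ { (e , w) → e , trans (cong₂ _+_ e w) refl }) (monomials-sound k 0 n))
monomials-sound (suc k) (suc d) n       = Allₚ.++⁺
  (Allₚ.map⁺ (All.map (λ { {m ∷ a} (e , w) → cong suc e , w }) (monomials-sound (suc k) d n)))
  (Allₚ.map⁺ (shift-elim (λ n → All (Of (suc d) n ∘ (0 ∷_))) (suc d) (λ _ _ → [])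
    (λ n → All.map (λ { (e , w) → e , cong₂ _+_ e w }) (monomials-sound k (suc d) n)) n))

monomials-complete : ∀ {k} (a : Mon k) → a ∈ monomials k (degree a) (weight a)
monomials-complete []              = here refl
monomials-complete {suc k} (zero ∷ a) = prepend (degree a) (weight a) (monomials-complete a)
  where
  prepend : ∀ d w → a ∈ monomials k d w → (0 ∷ a) ∈ monomials (suc k) d (d + w)
  prepend zero    w a∈ = ∈-map⁺ (0 ∷_) a∈
  prepend (suc d) w a∈ = ∈-++⁺ʳ _ (∈-map⁺ (0 ∷_)
    (subst (a ∈_) (sym (shift-≥ (suc d) (monomials k (suc d)) w)) a∈))
monomials-complete (suc n ∷ a)     = ∈-++⁺ˡ (∈-map⁺ incrementHead (monomials-complete (n ∷ a)))

monomials-unique : ∀ k d n → Unique (monomials k d n)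
monomials-unique zero    zero    zero    = [] ∷ []
monomials-unique zero    zero    (suc n) = []
monomials-unique zero    (suc d) n       = []
monomials-unique (suc k) zero    n       = Uniqueₚ.map⁺ (λ { refl → refl }) (monomials-unique k 0 n)
monomials-unique (suc k) (suc d) n       = Uniqueₚ.++⁺
  (Uniqueₚ.map⁺ (λ { {_ ∷ _} {_ ∷ _} refl → refl }) (monomials-unique (suc k) d n))
  (Uniqueₚ.map⁺ (λ { refl → refl })
    (shift-elim (λ _ → Unique) (suc d) (λ _ _ → []) (monomials-unique k (suc d)) n))
  disjoint
  where
  disjoint : ∀ {a} → ¬ (a ∈ List.map incrementHead (monomials (suc k) d n) ×
    a ∈ List.map (0 ∷_) (shift [] (suc d) (monomials k (suc d)) n))
  disjoint (p , q) with ∈-map⁻ incrementHead p | ∈-map⁻ (0 ∷_) q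
  ... | (_ ∷ _) , _ , refl | _ , _ , ()

-- The sl₂-action on polynomials

-- A polynomial, or indeed a power series, is given by its coefficients.
Poly : ℕ → Set
Poly k = Mon k → ℤ

infix 4 _≈_
_≈_ : ∀ {k} → Poly k → Poly k → Set
f ≈ g = ∀ a → f a ≡ g a

zeroPoly : ∀ {k} → Poly k
zeroPoly _ = 0ℤ

Supported : ∀ {k} → ℕ → ℕ → Poly k → Set
Supported d n f = ∀ a → ¬ Of d n a → f a ≡ 0ℤ

of? : ∀ {k} d n (a : Mon k) → Dec (Of d n a)
of? d n a = (degree a ≟ d) ×-dec (weight a ≟ n)

multHead : ∀ {k} → Poly (suc k) → Poly (suc k)
multHead f (zero  ∷ a) = 0ℤ
multHead f (suc n ∷ a) = f (n ∷ a)

diffHead : ∀ {k} → Poly (suc k) → Poly (suc k)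
diffHead f (n ∷ a) = + suc n ℤ.* f (suc n ∷ a)

-- The operator x₀ ∂/∂x₁.
lowerHead : ∀ {k} → Poly (suc (suc k)) → Poly (suc (suc k))
lowerHead f (zero  ∷ b) = 0ℤ
lowerHead f (suc n ∷ b) = diffHead (λ c → f (n ∷ c)) b

-- The operator x₁ ∂/∂x₀.
raiseHead : ∀ {k} → Poly (suc (suc k)) → Poly (suc (suc k))
raiseHead f (n ∷ b) = + suc n ℤ.* multHead (λ c → f (suc n ∷ c)) b

-- Σ xᵢ ∂/∂xᵢ₊₁
lower : ∀ {k} → Poly k → Poly k
lower f []          = 0ℤ
lower f (n ∷ [])    = 0ℤ
lower f (n ∷ m ∷ a) = lowerHead f (n ∷ m ∷ a) ℤ.+ lower (λ b → f (n ∷ b)) (m ∷ a)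

-- Σ (t + i)(ℓ - i) xᵢ₊₁ ∂/∂xᵢ in the variables x₀, …, x_ℓ; the case t = 1 completes lower to an sl₂-triple.
raise : ∀ {k} → ℤ → Poly k → Poly k
raise t f []                    = 0ℤ
raise t f (n ∷ [])              = 0ℤ
raise {suc (suc k)} t f (n ∷ m ∷ a) =
  t ℤ.* + suc k ℤ.* raiseHead f (n ∷ m ∷ a) ℤ.+ raise (1ℤ ℤ.+ t) (λ b → f (n ∷ b)) (m ∷ a)

multHead-cong : ∀ {k} {f g : Poly (suc k)} → f ≈ g → multHead f ≈ multHead g
multHead-cong h (zero  ∷ a) = refl
multHead-cong h (suc n ∷ a) = h (n ∷ a)

multHead-+ : ∀ {k} (f g : Poly (suc k)) a → multHead (λ b → f b ℤ.+ g b) a ≡ multHead f a ℤ.+ multHead g a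
multHead-+ f g (zero  ∷ a) = refl
multHead-+ f g (suc n ∷ a) = refl

multHead-* : ∀ {k} x (f : Poly (suc k)) a → multHead (λ b → x ℤ.* f b) a ≡ x ℤ.* multHead f a
multHead-* x f (zero  ∷ a) = sym (ℤₚ.*-zeroʳ x)
multHead-* x f (suc n ∷ a) = refl

multHead-0 : ∀ {k} (a : Mon (suc k)) → multHead zeroPoly a ≡ 0ℤ
multHead-0 (zero  ∷ a) = refl
multHead-0 (suc n ∷ a) = refl

diffHead-cong : ∀ {k} {f g : Poly (suc k)} → f ≈ g → diffHead f ≈ diffHead g
diffHead-cong h (n ∷ a) = cong (+ suc n ℤ.*_) (h (suc n ∷ a))

diffHead-+ : ∀ {k} (f g : Poly (suc k)) a → diffHead (λ b → f b ℤ.+ g b) a ≡ diffHead f a ℤ.+ diffHead g a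
diffHead-+ f g (n ∷ a) = ℤₚ.*-distribˡ-+ (+ suc n) (f (suc n ∷ a)) (g (suc n ∷ a))

*-left-comm : ∀ x y z → x ℤ.* (y ℤ.* z) ≡ y ℤ.* (x ℤ.* z)
*-left-comm = ℤSolver.solve-∀

diffHead-* : ∀ {k} x (f : Poly (suc k)) a → diffHead (λ b → x ℤ.* f b) a ≡ x ℤ.* diffHead f a
diffHead-* x f (n ∷ a) = *-left-comm (+ suc n) x _

diffHead-0 : ∀ {k} (a : Mon (suc k)) → diffHead zeroPoly a ≡ 0ℤ
diffHead-0 (n ∷ a) = ℤₚ.*-zeroʳ (+ suc n)

+-interchange : ∀ a b c d → (a ℤ.+ b) ℤ.+ (c ℤ.+ d) ≡ (a ℤ.+ c) ℤ.+ (b ℤ.+ d)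
+-interchange = ℤSolver.solve-∀

lower-linear : ∀ {k} → Linear (lower {k})
lower-linear = record
  { preserves-cong = lower-cong
  ; preserves-0 = lower-0
  ; preserves-+ = lower-+
  ; preserves-* = lower-*
  }
  where
  lower-cong : ∀ {k} {f g : Poly k} → f ≈ g → lower f ≈ lower g
  lower-cong h []              = refl
  lower-cong h (n ∷ [])        = refl
  lower-cong h (zero ∷ m ∷ a)  = cong (λ z → 0ℤ ℤ.+ z) (lower-cong (h ∘ (0 ∷_)) (m ∷ a))
  lower-cong h (suc n ∷ m ∷ a) =
    cong₂ ℤ._+_ (diffHead-cong (h ∘ (n ∷_)) (m ∷ a)) (lower-cong (h ∘ (suc n ∷_)) (m ∷ a))
  lower-0 : ∀ {k} (a : Mon k) → lower zeroPoly a ≡ 0ℤ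
  lower-0 []              = refl
  lower-0 (n ∷ [])        = refl
  lower-0 (zero ∷ m ∷ a)  = cong (λ z → 0ℤ ℤ.+ z) (lower-0 (m ∷ a))
  lower-0 (suc n ∷ m ∷ a) = cong₂ ℤ._+_ (diffHead-0 (m ∷ a)) (lower-0 (m ∷ a))
  lower-+ : ∀ {k} (f g : Poly k) a → lower (λ b → f b ℤ.+ g b) a ≡ lower f a ℤ.+ lower g a
  lower-+ f g []              = refl
  lower-+ f g (n ∷ [])        = refl
  lower-+ f g (zero ∷ m ∷ a)  = trans (cong (λ z → 0ℤ ℤ.+ z) (lower-+ (f ∘ (0 ∷_)) (g ∘ (0 ∷_)) (m ∷ a)))
    (+-interchange 0ℤ 0ℤ (lower (f ∘ (0 ∷_)) (m ∷ a)) (lower (g ∘ (0 ∷_)) (m ∷ a)))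
  lower-+ f g (suc n ∷ m ∷ a) = trans (cong₂ ℤ._+_ (diffHead-+ (f ∘ (n ∷_)) (g ∘ (n ∷_)) (m ∷ a))
    (lower-+ (f ∘ (suc n ∷_)) (g ∘ (suc n ∷_)) (m ∷ a))) (+-interchange (diffHead (f ∘ (n ∷_)) (m ∷ a)) _ _ _)
  lower-* : ∀ {k} x (f : Poly k) a → lower (λ b → x ℤ.* f b) a ≡ x ℤ.* lower f a
  lower-* x f []              = sym (ℤₚ.*-zeroʳ x)
  lower-* x f (n ∷ [])        = sym (ℤₚ.*-zeroʳ x)
  lower-* x f (zero ∷ m ∷ a)  = trans (cong₂ ℤ._+_ (sym (ℤₚ.*-zeroʳ x)) (lower-* x (f ∘ (0 ∷_)) (m ∷ a)))
    (sym (ℤₚ.*-distribˡ-+ x 0ℤ _))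
  lower-* x f (suc n ∷ m ∷ a) = trans (cong₂ ℤ._+_ (diffHead-* x (f ∘ (n ∷_)) (m ∷ a)) (lower-* x (f ∘ (suc n ∷_)) (m ∷ a)))
    (sym (ℤₚ.*-distribˡ-+ x (diffHead (f ∘ (n ∷_)) (m ∷ a)) _))

raise-linear : ∀ {k} t → Linear (raise {k} t)
raise-linear t = record
  { preserves-cong = raise-cong t
  ; preserves-0 = raise-0 t
  ; preserves-+ = raise-+ t
  ; preserves-* = raise-* t
  }
  where
  raise-cong : ∀ {k} t {f g : Poly k} → f ≈ g → raise t f ≈ raise t g
  raise-cong t h []          = refl
  raise-cong t h (n ∷ [])    = refl
  raise-cong {suc (suc k)} t h (n ∷ m ∷ a) =
    cong₂ ℤ._+_ (cong (λ z → t ℤ.* + suc k ℤ.* (+ suc n ℤ.* z)) (multHead-cong (h ∘ (suc n ∷_)) (m ∷ a)))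
      (raise-cong (1ℤ ℤ.+ t) (h ∘ (n ∷_)) (m ∷ a))
  raise-0 : ∀ {k} t (a : Mon k) → raise t zeroPoly a ≡ 0ℤ
  raise-0 t []          = refl
  raise-0 t (n ∷ [])    = refl
  raise-0 {suc (suc k)} t (n ∷ m ∷ a) = trans
    (cong₂ ℤ._+_ (cong (λ z → t ℤ.* + suc k ℤ.* (+ suc n ℤ.* z)) (multHead-0 (m ∷ a))) (raise-0 (1ℤ ℤ.+ t) (m ∷ a)))
    (annihilate (t ℤ.* + suc k) (+ suc n))
    where
    annihilate : ∀ x y → x ℤ.* (y ℤ.* 0ℤ) ℤ.+ 0ℤ ≡ 0ℤ
    annihilate = ℤSolver.solve-∀
  raise-+ : ∀ {k} t (f g : Poly k) a → raise t (λ b → f b ℤ.+ g b) a ≡ raise t f a ℤ.+ raise t g a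
  raise-+ t f g []          = refl
  raise-+ t f g (n ∷ [])    = refl
  raise-+ {suc (suc k)} t f g (n ∷ m ∷ a) = trans
    (cong₂ ℤ._+_ (cong (λ z → t ℤ.* + suc k ℤ.* (+ suc n ℤ.* z)) (multHead-+ (f ∘ (suc n ∷_)) (g ∘ (suc n ∷_)) (m ∷ a)))
      (raise-+ (1ℤ ℤ.+ t) (f ∘ (n ∷_)) (g ∘ (n ∷_)) (m ∷ a)))
    (distribute (t ℤ.* + suc k) (+ suc n) _ _ _ _)
    where
    distribute : ∀ x y u v p q → x ℤ.* (y ℤ.* (u ℤ.+ v)) ℤ.+ (p ℤ.+ q) ≡
      (x ℤ.* (y ℤ.* u) ℤ.+ p) ℤ.+ (x ℤ.* (y ℤ.* v) ℤ.+ q)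
    distribute = ℤSolver.solve-∀
  raise-* : ∀ {k} t x (f : Poly k) a → raise t (λ b → x ℤ.* f b) a ≡ x ℤ.* raise t f a
  raise-* t x f []          = sym (ℤₚ.*-zeroʳ x)
  raise-* t x f (n ∷ [])    = sym (ℤₚ.*-zeroʳ x)
  raise-* {suc (suc k)} t x f (n ∷ m ∷ a) = trans
    (cong₂ ℤ._+_ (cong (λ z → t ℤ.* + suc k ℤ.* (+ suc n ℤ.* z)) (multHead-* x (f ∘ (suc n ∷_)) (m ∷ a)))
      (raise-* (1ℤ ℤ.+ t) x (f ∘ (n ∷_)) (m ∷ a)))
    (distribute (t ℤ.* + suc k) (+ suc n) x _ _)
    where
    distribute : ∀ y z x u p → y ℤ.* (z ℤ.* (x ℤ.* u)) ℤ.+ x ℤ.* p ≡ x ℤ.* (y ℤ.* (z ℤ.* u) ℤ.+ p)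
    distribute = ℤSolver.solve-∀

module Lower {k} = Linear (lower-linear {k})
module Raise {k} t = Linear (raise-linear {k} t)

-- The derivation annihilates x₀, so it commutes with multiplication by x₀.
lower-multHead : ∀ {k} (f : Poly (suc k)) → lower (multHead f) ≈ multHead (lower f)
lower-multHead f (zero  ∷ [])            = refl
lower-multHead f (suc n ∷ [])            = refl
lower-multHead f (zero  ∷ m ∷ a)         = cong (λ z → 0ℤ ℤ.+ z) (Lower.preserves-0 (m ∷ a))
lower-multHead f (suc zero ∷ m ∷ a)      = cong₂ ℤ._+_ (ℤₚ.*-zeroʳ (+ suc m)) refl
lower-multHead f (suc (suc n) ∷ m ∷ a)   = refl

-- x₀ occurs in no coefficient of this differential operator, so it commutes with ∂/∂x₀.
raise-diffHead : ∀ {k} t (f : Poly (suc k)) → raise t (diffHead f) ≈ diffHead (raise t f)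
raise-diffHead t f (n ∷ [])    = sym (ℤₚ.*-zeroʳ (+ suc n))
raise-diffHead {suc k} t f (n ∷ m ∷ a) = trans
  (cong₂ ℤ._+_
    (cong (λ z → t ℤ.* + suc k ℤ.* (+ suc n ℤ.* z)) (multHead-* (+ suc (suc n)) (λ c → f (suc (suc n) ∷ c)) (m ∷ a)))
    (Raise.preserves-* (1ℤ ℤ.+ t) (+ suc n) (λ b → f (suc n ∷ b)) (m ∷ a)))
  (distribute (t ℤ.* + suc k) (+ suc n) (+ suc (suc n)) _ _)
  where
  distribute : ∀ x y z u p → x ℤ.* (y ℤ.* (z ℤ.* u)) ℤ.+ y ℤ.* p ≡ y ℤ.* (x ℤ.* (z ℤ.* u) ℤ.+ p)
  distribute = ℤSolver.solve-∀

-- The diagonal operator arising as the commutator: each pair of neighbouring variables contributes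
-- [x₀∂₁, x₁∂₀] = x₀∂₀ - x₁∂₁, scaled by the coefficient from `raise`.
eigenvalue : ∀ {k} → ℤ → Mon k → ℤ
eigenvalue t []          = 0ℤ
eigenvalue t (n ∷ [])    = 0ℤ
eigenvalue {suc (suc k)} t (n ∷ m ∷ a) = t ℤ.* + suc k ℤ.* (+ n ℤ.- + m) ℤ.+ eigenvalue (1ℤ ℤ.+ t) (m ∷ a)

multHead-diffHead : ∀ {k} (f : Poly (suc k)) m a → multHead (diffHead f) (m ∷ a) ≡ + m ℤ.* f (m ∷ a)
multHead-diffHead f zero    a = refl
multHead-diffHead f (suc m) a = refl

-- Induction on the number of variables, splitting off x₀. The mixed commutators vanish by
-- `lower-multHead` and `raise-diffHead`, applied to the tail, whose head is x₁. The parameter `t`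
-- has to be general: on the tail the coefficients (t + i)(ℓ - i) have the same form with t + 1 and
-- ℓ - 1.
commutator : ∀ {k} t (f : Poly (suc k)) a →
  lower (raise t f) a ≡ raise t (lower f) a ℤ.+ eigenvalue t a ℤ.* f a
commutator t f (n ∷ []) = refl
commutator {suc k} t f (n ∷ m ∷ a) = begin
  lowerHead (raise t f) (n ∷ b) ℤ.+ lower (λ b → raise t f (n ∷ b)) b
    ≡⟨ cong (λ z → lowerHead (raise t f) (n ∷ b) ℤ.+ z) tail ⟩
  lowerHead (raise t f) (n ∷ b) ℤ.+ (g ℤ.* (+ suc n ℤ.* XDf) ℤ.+ (UDf ℤ.+ H ℤ.* y))
    ≡⟨ cases n refl ⟩
  g ℤ.* (+ suc n ℤ.* (+ m ℤ.* y ℤ.+ XDf)) ℤ.+ (raise t′ (λ b → lowerHead f (n ∷ b)) b ℤ.+ UDf)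
    ℤ.+ (g ℤ.* (+ n ℤ.- + m) ℤ.+ H) ℤ.* y
    ≡⟨ cong₂ (λ u v → g ℤ.* (+ suc n ℤ.* u) ℤ.+ v ℤ.+ (g ℤ.* (+ n ℤ.- + m) ℤ.+ H) ℤ.* y) (sym head) (sym rest) ⟩
  raise t (lower f) (n ∷ b) ℤ.+ eigenvalue t (n ∷ b) ℤ.* f (n ∷ b) ∎
  where
  open ≡-Reasoning
  b = m ∷ a
  g = t ℤ.* + suc k
  t′ = 1ℤ ℤ.+ t
  y = f (n ∷ b)
  XDf = multHead (lower (λ c → f (suc n ∷ c))) b
  UDf = raise t′ (lower (λ c → f (n ∷ c))) b
  H = eigenvalue t′ b
  unfold : ∀ b → raise t f (n ∷ b) ≡ g ℤ.* (+ suc n ℤ.* multHead (λ c → f (suc n ∷ c)) b) ℤ.+ raise t′ (λ c → f (n ∷ c)) b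
  unfold (m ∷ a) = refl
  tail : lower (λ b → raise t f (n ∷ b)) b ≡ g ℤ.* (+ suc n ℤ.* XDf) ℤ.+ (UDf ℤ.+ H ℤ.* y)
  tail = begin
    lower (λ b → raise t f (n ∷ b)) b
      ≡⟨ Lower.preserves-cong unfold b ⟩
    lower (λ b → g ℤ.* (+ suc n ℤ.* multHead (λ c → f (suc n ∷ c)) b) ℤ.+ raise t′ (λ c → f (n ∷ c)) b) b
      ≡⟨ Lower.preserves-+ _ (raise t′ (λ c → f (n ∷ c))) b ⟩
    lower (λ b → g ℤ.* (+ suc n ℤ.* multHead (λ c → f (suc n ∷ c)) b)) b ℤ.+ lower (raise t′ (λ c → f (n ∷ c))) b
      ≡⟨ cong₂ ℤ._+_
          (trans (Lower.preserves-* g _ b) (cong (g ℤ.*_) (trans (Lower.preserves-* (+ suc n) _ b)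
            (cong (+ suc n ℤ.*_) (lower-multHead (λ c → f (suc n ∷ c)) b)))))
          (commutator t′ (λ c → f (n ∷ c)) b) ⟩
    g ℤ.* (+ suc n ℤ.* XDf) ℤ.+ (UDf ℤ.+ H ℤ.* y) ∎
  unfoldLower : ∀ n b → lower f (n ∷ b) ≡ lowerHead f (n ∷ b) ℤ.+ lower (λ c → f (n ∷ c)) b
  unfoldLower n (m ∷ a) = refl
  head : multHead (λ c → lower f (suc n ∷ c)) b ≡ + m ℤ.* y ℤ.+ XDf
  head = begin
    multHead (λ c → lower f (suc n ∷ c)) b
      ≡⟨ multHead-cong (unfoldLower (suc n)) b ⟩
    multHead (λ c → diffHead (λ e → f (n ∷ e)) c ℤ.+ lower (λ e → f (suc n ∷ e)) c) b
      ≡⟨ multHead-+ (diffHead (λ e → f (n ∷ e))) _ b ⟩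
    multHead (diffHead (λ e → f (n ∷ e))) b ℤ.+ XDf
      ≡⟨ cong (ℤ._+ XDf) (multHead-diffHead (λ e → f (n ∷ e)) m a) ⟩
    + m ℤ.* y ℤ.+ XDf ∎
  rest : raise t′ (λ c → lower f (n ∷ c)) b ≡ raise t′ (λ c → lowerHead f (n ∷ c)) b ℤ.+ UDf
  rest = trans (Raise.preserves-cong t′ (unfoldLower n) b) (Raise.preserves-+ t′ (λ c → lowerHead f (n ∷ c)) _ b)
  -- `lowerHead` branches on the exponent of x₀: for exponent 0 it vanishes, and otherwise
  -- `raise-diffHead` applies. The equation allows the case split while the names above stay in
  -- scope.
  cases : ∀ n′ → n ≡ n′ →
    lowerHead (raise t f) (n ∷ b) ℤ.+ (g ℤ.* (+ suc n ℤ.* XDf) ℤ.+ (UDf ℤ.+ H ℤ.* y)) ≡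
    g ℤ.* (+ suc n ℤ.* (+ m ℤ.* y ℤ.+ XDf)) ℤ.+ (raise t′ (λ b → lowerHead f (n ∷ b)) b ℤ.+ UDf)
      ℤ.+ (g ℤ.* (+ n ℤ.- + m) ℤ.+ H) ℤ.* y
  cases zero refl = trans (identity g (+ m) y XDf UDf H)
    (cong (λ z → g ℤ.* (1ℤ ℤ.* (+ m ℤ.* y ℤ.+ XDf)) ℤ.+ (z ℤ.+ UDf) ℤ.+ (g ℤ.* (0ℤ ℤ.- + m) ℤ.+ H) ℤ.* y)
      (sym (Raise.preserves-0 t′ b)))
    where
    identity : ∀ g m y p q h → 0ℤ ℤ.+ (g ℤ.* (1ℤ ℤ.* p) ℤ.+ (q ℤ.+ h ℤ.* y)) ≡
      g ℤ.* (1ℤ ℤ.* (m ℤ.* y ℤ.+ p)) ℤ.+ (0ℤ ℤ.+ q) ℤ.+ (g ℤ.* (0ℤ ℤ.- m) ℤ.+ h) ℤ.* y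
    identity = ℤSolver.solve-∀
  cases (suc i) refl = trans
    (identity g (+ i) (+ m) y XDf UDf H (raise t′ (λ c → f (i ∷ c)) (suc m ∷ a)))
    (cong (λ z → g ℤ.* (+ suc n ℤ.* (+ m ℤ.* y ℤ.+ XDf)) ℤ.+ (z ℤ.+ UDf) ℤ.+ (g ℤ.* (+ n ℤ.- + m) ℤ.+ H) ℤ.* y)
      (sym (raise-diffHead t′ (λ c → f (i ∷ c)) b)))
    where
    identity : ∀ g i m y p q h s →
      (1ℤ ℤ.+ m) ℤ.* (g ℤ.* ((1ℤ ℤ.+ i) ℤ.* y) ℤ.+ s) ℤ.+ (g ℤ.* ((1ℤ ℤ.+ (1ℤ ℤ.+ i)) ℤ.* p) ℤ.+ (q ℤ.+ h ℤ.* y)) ≡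
      g ℤ.* ((1ℤ ℤ.+ (1ℤ ℤ.+ i)) ℤ.* (m ℤ.* y ℤ.+ p)) ℤ.+ ((1ℤ ℤ.+ m) ℤ.* s ℤ.+ q)
        ℤ.+ (g ℤ.* ((1ℤ ℤ.+ i) ℤ.- m) ℤ.+ h) ℤ.* y
    identity = ℤSolver.solve-∀

-- At t = 1 this gives the eigenvalue kd - 2w, where d and w are the degree and weight of the whole
-- monomial; in particular it is constant on a weight space.
eigenvalue-formula : ∀ {k} t n (a : Mon k) →
  eigenvalue t (n ∷ a) ℤ.+ (1ℤ ℤ.+ 1ℤ) ℤ.* + weight (n ∷ a) ℤ.+ t ℤ.* + degree a ≡
  t ℤ.* + k ℤ.* + n ℤ.+ + suc k ℤ.* + degree a
eigenvalue-formula t n [] = identity t (+ n)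
  where
  identity : ∀ t n → 0ℤ ℤ.+ (1ℤ ℤ.+ 1ℤ) ℤ.* 0ℤ ℤ.+ t ℤ.* 0ℤ ≡ t ℤ.* 0ℤ ℤ.* n ℤ.+ 1ℤ ℤ.* 0ℤ
  identity = ℤSolver.solve-∀
eigenvalue-formula {suc k} t n (m ∷ a) = trans
  (before t (+ n) (+ m) (+ k) (+ degree a) (+ weight a) (eigenvalue (1ℤ ℤ.+ t) (m ∷ a)))
  (trans (cong (λ z → t ℤ.* (1ℤ ℤ.+ + k) ℤ.* (+ n ℤ.- + m) ℤ.+ z ℤ.+ (+ degree a ℤ.+ (1ℤ ℤ.+ 1ℤ ℤ.+ t) ℤ.* + m)) (eigenvalue-formula (1ℤ ℤ.+ t) m a))
    (after t (+ n) (+ m) (+ k) (+ degree a)))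
  where
  before : ∀ t n m k d w e →
    t ℤ.* (1ℤ ℤ.+ k) ℤ.* (n ℤ.- m) ℤ.+ e ℤ.+ (1ℤ ℤ.+ 1ℤ) ℤ.* ((m ℤ.+ d) ℤ.+ (d ℤ.+ w)) ℤ.+ t ℤ.* (m ℤ.+ d) ≡
    t ℤ.* (1ℤ ℤ.+ k) ℤ.* (n ℤ.- m) ℤ.+ (e ℤ.+ (1ℤ ℤ.+ 1ℤ) ℤ.* (d ℤ.+ w) ℤ.+ (1ℤ ℤ.+ t) ℤ.* d) ℤ.+ (d ℤ.+ (1ℤ ℤ.+ 1ℤ ℤ.+ t) ℤ.* m)
  before = ℤSolver.solve-∀
  after : ∀ t n m k d →
    t ℤ.* (1ℤ ℤ.+ k) ℤ.* (n ℤ.- m) ℤ.+ ((1ℤ ℤ.+ t) ℤ.* k ℤ.* m ℤ.+ (1ℤ ℤ.+ k) ℤ.* d) ℤ.+ (d ℤ.+ (1ℤ ℤ.+ 1ℤ ℤ.+ t) ℤ.* m) ≡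
    t ℤ.* (1ℤ ℤ.+ k) ℤ.* n ℤ.+ (1ℤ ℤ.+ (1ℤ ℤ.+ k)) ℤ.* (m ℤ.+ d)
  after = ℤSolver.solve-∀

lower-local : ∀ {k} (f : Poly k) a →
  (∀ b → degree b ≡ degree a → weight b ≡ suc (weight a) → f b ≡ 0ℤ) → lower f a ≡ 0ℤ
lower-local f []              h = refl
lower-local f (n ∷ [])        h = refl
lower-local f (zero ∷ m ∷ a)  h = cong (λ z → 0ℤ ℤ.+ z) (lower-local (λ b → f (0 ∷ b)) (m ∷ a)
  λ b d w → h (0 ∷ b) d (trans (cong₂ _+_ d w) (+-suc _ _)))
lower-local f (suc n ∷ m ∷ a) h = cong₂ ℤ._+_
  (trans (cong (+ suc m ℤ.*_) (h (n ∷ suc m ∷ a) (+-suc n _) refl)) (ℤₚ.*-zeroʳ (+ suc m)))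
  (lower-local (λ b → f (suc n ∷ b)) (m ∷ a)
    λ b d w → h (suc n ∷ b) (cong (λ z → suc n + z) d) (trans (cong₂ _+_ d w) (+-suc _ _)))

raise-local : ∀ {k} t (f : Poly k) a →
  (∀ b → degree b ≡ degree a → suc (weight b) ≡ weight a → f b ≡ 0ℤ) → raise t f a ≡ 0ℤ
raise-local t f []          h = refl
raise-local t f (n ∷ [])    h = refl
raise-local {suc (suc k)} t f (n ∷ m ∷ a) h = trans
  (cong₂ ℤ._+_ (cong (λ z → t ℤ.* + suc k ℤ.* (+ suc n ℤ.* z)) (head m h))
    (raise-local (1ℤ ℤ.+ t) (λ b → f (n ∷ b)) (m ∷ a)
      λ b d w → h (n ∷ b) (cong (λ z → n + z) d) (trans (sym (+-suc (degree b) _)) (cong₂ _+_ d w))))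
  (annihilate (t ℤ.* + suc k) (+ suc n))
  where
  annihilate : ∀ x y → x ℤ.* (y ℤ.* 0ℤ) ℤ.+ 0ℤ ≡ 0ℤ
  annihilate = ℤSolver.solve-∀
  head : ∀ m → (∀ b → degree b ≡ degree (n ∷ m ∷ a) → suc (weight b) ≡ weight (n ∷ m ∷ a) → f b ≡ 0ℤ) →
    multHead (λ c → f (suc n ∷ c)) (m ∷ a) ≡ 0ℤ
  head zero    h = refl
  head (suc m) h = h (suc n ∷ m ∷ a) (sym (+-suc n _)) refl

lower-supported : ∀ {k d n} {f : Poly k} → Supported d (suc n) f → Supported d n (lower f)
lower-supported {f = f} supp a ¬of = lower-local f a
  λ b d w → supp b λ { (d′ , w′) → ¬of (trans (sym d) d′ , suc-injective (trans (sym w) w′)) }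

raise-supported : ∀ {k d n} t {f : Poly k} → Supported d n f → Supported d (suc n) (raise t f)
raise-supported t {f} supp a ¬of = raise-local t f a
  λ b d w → supp b λ { (d′ , w′) → ¬of (trans (sym d) d′ , trans (sym w) (cong suc w′)) }

lower-weightZero : ∀ {k d} {f : Poly k} → Supported d 0 f → lower f ≈ zeroPoly
lower-weightZero {f = f} supp a = lower-local f a λ b d w → supp b λ { (_ , w′) → 1+n≢0 (trans (sym w) w′) }

-- The eigenvalue kd - 2n is carried as a natural number `w`, so its mere existence says that the
-- weight is not above the middle.
commutator-weight : ∀ {k d n w} {f : Poly (suc k)} → Supported d n f → w + 2 * n ≡ k * d →
  ∀ a → lower (raise 1ℤ f) a ≡ raise 1ℤ (lower f) a ℤ.+ + w ℤ.* f a
commutator-weight {k} {d} {n} {w} {f} supp eq a = trans (commutator 1ℤ f a) (cong (λ z → raise 1ℤ (lower f) a ℤ.+ z) (step (of? d n a)))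
  where
  step : Dec (Of d n a) → eigenvalue 1ℤ a ℤ.* f a ≡ + w ℤ.* f a
  step (no ¬of) = trans (cong (eigenvalue 1ℤ a ℤ.*_) (supp a ¬of)) (trans (ℤₚ.*-zeroʳ (eigenvalue 1ℤ a))
    (sym (trans (cong (+ w ℤ.*_) (supp a ¬of)) (ℤₚ.*-zeroʳ (+ w)))))
  step (yes (refl , refl)) = cong (ℤ._* f a) (value a eq)
    where
    value : ∀ (a : Mon (suc k)) → w + 2 * weight a ≡ k * degree a → eigenvalue 1ℤ a ≡ + w
    value (m ∷ a) eq = trans (sym (add-cancel (eigenvalue 1ℤ (m ∷ a)) (+ weight (m ∷ a)) (+ degree a)))
      (trans (cong (λ z → z ℤ.- (1ℤ ℤ.+ 1ℤ) ℤ.* + weight (m ∷ a) ℤ.- 1ℤ ℤ.* + degree a) (eigenvalue-formula 1ℤ m a))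
      (trans (regroup (+ k) (+ m) (+ degree a) (+ weight (m ∷ a)))
      (trans (cong (λ z → z ℤ.- (1ℤ ℤ.+ 1ℤ) ℤ.* + weight (m ∷ a)) (sym eqℤ)) (cancel (+ w) (+ weight (m ∷ a))))))
      where
      add-cancel : ∀ e w d → e ℤ.+ (1ℤ ℤ.+ 1ℤ) ℤ.* w ℤ.+ 1ℤ ℤ.* d ℤ.- (1ℤ ℤ.+ 1ℤ) ℤ.* w ℤ.- 1ℤ ℤ.* d ≡ e
      add-cancel = ℤSolver.solve-∀
      regroup : ∀ k m d w → 1ℤ ℤ.* k ℤ.* m ℤ.+ (1ℤ ℤ.+ k) ℤ.* d ℤ.- (1ℤ ℤ.+ 1ℤ) ℤ.* w ℤ.- 1ℤ ℤ.* d ≡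
        k ℤ.* (m ℤ.+ d) ℤ.- (1ℤ ℤ.+ 1ℤ) ℤ.* w
      regroup = ℤSolver.solve-∀
      cancel : ∀ x w → x ℤ.+ (1ℤ ℤ.+ 1ℤ) ℤ.* w ℤ.- (1ℤ ℤ.+ 1ℤ) ℤ.* w ≡ x
      cancel = ℤSolver.solve-∀
      eqℤ : + w ℤ.+ (1ℤ ℤ.+ 1ℤ) ℤ.* + weight (m ∷ a) ≡ + k ℤ.* (+ m ℤ.+ + degree a)
      eqℤ = trans (cong (λ z → + w ℤ.+ z) (sym (ℤₚ.pos-* 2 (weight (m ∷ a)))))
        (trans (cong +_ eq) (ℤₚ.pos-* k (m + degree a)))

scaled-zero : ∀ μ x → + suc μ ℤ.* x ≡ 0ℤ → x ≡ 0ℤ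
scaled-zero μ x eq = [ (λ ()) , (λ z → z) ]′ (ℤₚ.i*j≡0⇒i≡0∨j≡0 (+ suc μ) eq)

-- If raise (lower f) = - μ f then raise (lower g) = - (μ + w) g for g = lower f, w being the eigenvalue of the
-- commutator on g; since lower is locally nilpotent, f vanishes.
raise-lower-eigen : ∀ {k d} n {w} μ (f : Poly (suc k)) → Supported d n f → w + 2 * n ≡ k * d →
  (∀ a → raise 1ℤ (lower f) a ℤ.+ + suc μ ℤ.* f a ≡ 0ℤ) → f ≈ zeroPoly
raise-lower-eigen zero μ f supp eq h a = scaled-zero μ (f a) (trans (sym (trans
  (cong (ℤ._+ + suc μ ℤ.* f a) (trans (Raise.preserves-cong 1ℤ (lower-weightZero supp) a) (Raise.preserves-0 1ℤ a)))
  (ℤₚ.+-identityˡ _))) (h a))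
raise-lower-eigen {k} {d} (suc n) {w} μ f supp eq h a = scaled-zero μ (f a) (trans (sym (trans
  (cong (ℤ._+ + suc μ ℤ.* f a) (trans (Raise.preserves-cong 1ℤ lower≈0 a) (Raise.preserves-0 1ℤ a)))
  (ℤₚ.+-identityˡ _))) (h a))
  where
  w′ = 2 + w
  eq′ : w′ + 2 * n ≡ k * d
  eq′ = trans (move w n) eq
    where
    move : ∀ w n → 2 + w + 2 * n ≡ w + 2 * suc n
    move = ℕSolver.solve-∀
  g = lower f
  g-eigen : ∀ a → raise 1ℤ (lower g) a ℤ.+ + (suc μ + w′) ℤ.* g a ≡ 0ℤ
  g-eigen a = begin
    raise 1ℤ (lower g) a ℤ.+ (+ suc μ ℤ.+ + w′) ℤ.* g a
      ≡⟨ regroup (raise 1ℤ (lower g) a) (+ suc μ) (+ w′) (g a) ⟩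
    (raise 1ℤ (lower g) a ℤ.+ + w′ ℤ.* g a) ℤ.+ + suc μ ℤ.* g a
      ≡⟨ cong (ℤ._+ + suc μ ℤ.* g a) (sym (commutator-weight {w = w′} (lower-supported supp) eq′ a)) ⟩
    lower (raise 1ℤ g) a ℤ.+ + suc μ ℤ.* g a
      ≡⟨ cong (λ z → lower (raise 1ℤ g) a ℤ.+ z) (sym (Lower.preserves-* (+ suc μ) f a)) ⟩
    lower (raise 1ℤ g) a ℤ.+ lower (λ b → + suc μ ℤ.* f b) a
      ≡⟨ sym (Lower.preserves-+ (raise 1ℤ g) _ a) ⟩
    lower (λ b → raise 1ℤ g b ℤ.+ + suc μ ℤ.* f b) a
      ≡⟨ trans (Lower.preserves-cong h a) (Lower.preserves-0 a) ⟩
    0ℤ ∎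
    where
    open ≡-Reasoning
    regroup : ∀ r x y g → r ℤ.+ (x ℤ.+ y) ℤ.* g ≡ (r ℤ.+ y ℤ.* g) ℤ.+ x ℤ.* g
    regroup = ℤSolver.solve-∀
  lower≈0 : g ≈ zeroPoly
  lower≈0 = raise-lower-eigen n {w′} (μ + w′) g (lower-supported supp) eq′ g-eigen

-- If the left side of the commutator relation vanishes, `raise` after `lower` has the eigenvalue -w
-- on `f`, with w > 0 because the weight is strictly below the middle; `raise-lower-eigen` excludes
-- this for nonzero `f`.
lower-raise-injective : ∀ {k d n} (f : Poly (suc k)) → Supported d n f → 2 * n < k * d →
  lower (raise 1ℤ f) ≈ zeroPoly → f ≈ zeroPoly
lower-raise-injective {k} {d} {n} f supp 2n<kd h = raise-lower-eigen n {suc w} w f supp eq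
  (λ a → trans (sym (commutator-weight {w = suc w} supp eq a)) (h a))
  where
  w = k * d ∸ suc (2 * n)
  eq : suc w + 2 * n ≡ k * d
  eq = trans (sym (+-suc w (2 * n))) (m∸n+n≡m 2n<kd)

vanishing : ∀ {k d n} (f : Poly k) → Supported d n f → All (λ a → f a ≡ 0ℤ) (monomials k d n) → f ≈ zeroPoly
vanishing {d = d} {n} f supp zeros a with of? d n a
... | yes (refl , refl) = All.lookup zeros (monomials-complete a)
... | no ¬of            = supp a ¬of

-- Strict ascents and the kernel of the lowering operator

module _ {k : ℕ} where
  open Indicators (Vecₚ.≡-dec {n = k} _≟_) public

generic : ∀ {k d n} → Vec ℤ (length (monomials k d n)) → Poly k
generic {k} {d} {n} xs = combination xs (indicators (monomials k d n))

generic-supported : ∀ {k d n} xs → Supported d n (generic {k} {d} {n} xs)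
generic-supported {k} {d} {n} xs a ¬of =
  combination-outside (All.map (λ { of refl → ¬of of }) (monomials-sound k d n)) xs

LowerKernel : ℕ → ℕ → ℕ → Set
LowerKernel k d n = Σ[ f ∈ Poly k ] Supported d n f × ¬ f ≈ zeroPoly × lower f ≈ zeroPoly

-- The shift makes the coefficient before weight 0 equal to 0, so weight 0 is an ascent; no
-- truncated predecessor enters.
Ascent : ℕ → ℕ → ℕ → Set
Ascent k d n = shift 0 1 (count k d) n < count k d n

-- The unknowns are the coefficients at the monomials of weight `n`; there is one equation for each
-- monomial of weight n - 1, the only places where the image under `lower` can be nonzero.
ascent⇒kernel : ∀ {k d n} → Ascent k d n → LowerKernel k d n
ascent⇒kernel {k} {d} {n} ascent = generic xs , generic-supported xs ,
  (λ zero → indicators-independent (monomials-unique k d n) xs zero nontrivial) , kernel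
  where
  conditions = shift [] 1 (monomials k d) n
  fewer : length conditions < length (monomials k d n)
  fewer = subst₂ _<_
    (sym (trans (shift-∘ length 1 (monomials k d) n) (shift-cong 1 (length-monomials k d) n)))
    (sym (length-monomials k d n)) ascent
  solution = linearSystem (Vec.map lower (indicators (monomials k d n))) conditions fewer
  xs = proj₁ solution
  nontrivial = proj₁ (proj₂ solution)
  kernel : lower (generic xs) ≈ zeroPoly
  kernel a with (degree a ≟ d) | (suc (weight a) ≟ n)
  ... | yes d≡   | yes n≡   = trans (Lower.preserves-combination xs (indicators (monomials k d n)) a)
    (All.lookup (proj₂ (proj₂ solution)) (condition d≡ n≡))
    where
    condition : ∀ {d n} → degree a ≡ d → suc (weight a) ≡ n → a ∈ shift [] 1 (monomials k d) n
    condition refl refl = monomials-complete a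
  ... | no d≢    | _        = lower-local (generic xs) a
    λ b e w → generic-supported xs b λ { (e′ , _) → d≢ (trans (sym e) e′) }
  ... | yes _    | no n≢    = lower-local (generic xs) a
    λ b e w → generic-supported xs b λ { (_ , w′) → n≢ (trans (sym w) w′) }

-- Otherwise `f` and the raised monomials of weight `n` are more vectors than weight `suc n` has
-- monomials, and so satisfy a relation x f + raise g = 0. Applying `lower` removes `f`, and
-- injectivity gives g = 0. Then x f = 0, so x = 0 and the relation was trivial.
kernel⇒ascent : ∀ {k d n} → 2 * n < k * d → LowerKernel (suc k) d (suc n) → Ascent (suc k) d (suc n)
kernel⇒ascent {k} {d} {n} 2n<kd (f , supp , f≉0 , kernel) = ≰⇒> impossible
  where
  impossible : ¬ count (suc k) d (suc n) ≤ count (suc k) d n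
  impossible h with linearSystem (f ∷ Vec.map (raise 1ℤ) (indicators (monomials (suc k) d n)))
      (monomials (suc k) d (suc n))
      (s≤s (subst₂ _≤_ (sym (length-monomials (suc k) d (suc n))) (sym (length-monomials (suc k) d n)) h))
  ... | x ∷ xs , nontrivial , zeros = contradict nontrivial
    where
    open ≡-Reasoning
    g = generic {suc k} {d} {n} xs
    sum≈0 : ∀ a → x ℤ.* f a ℤ.+ raise 1ℤ g a ≡ 0ℤ
    sum≈0 = vanishing (λ a → x ℤ.* f a ℤ.+ raise 1ℤ g a)
      (λ a ¬of → cong₂ ℤ._+_ (trans (cong (x ℤ.*_) (supp a ¬of)) (ℤₚ.*-zeroʳ x))
        (raise-supported 1ℤ (generic-supported xs) a ¬of))
      (All.map (λ {a} → trans (cong (λ z → x ℤ.* f a ℤ.+ z) (Raise.preserves-combination 1ℤ xs _ a))) zeros)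
    lowerRaise≈0 : lower (raise 1ℤ g) ≈ zeroPoly
    lowerRaise≈0 a = begin
      lower (raise 1ℤ g) a
        ≡⟨ sym (ℤₚ.+-identityˡ _) ⟩
      0ℤ ℤ.+ lower (raise 1ℤ g) a
        ≡⟨ cong (ℤ._+ lower (raise 1ℤ g) a) (sym (trans (Lower.preserves-* x f a)
            (trans (cong (x ℤ.*_) (kernel a)) (ℤₚ.*-zeroʳ x)))) ⟩
      lower (λ b → x ℤ.* f b) a ℤ.+ lower (raise 1ℤ g) a
        ≡⟨ sym (Lower.preserves-+ (λ b → x ℤ.* f b) (raise 1ℤ g) a) ⟩
      lower (λ b → x ℤ.* f b ℤ.+ raise 1ℤ g b) a
        ≡⟨ trans (Lower.preserves-cong sum≈0 a) (Lower.preserves-0 a) ⟩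
      0ℤ ∎
    g≈0 : g ≈ zeroPoly
    g≈0 = lower-raise-injective g (generic-supported xs) 2n<kd lowerRaise≈0
    scaled : ∀ a → x ℤ.* f a ≡ 0ℤ
    scaled a = trans (sym (trans (cong (λ z → x ℤ.* f a ℤ.+ z)
      (trans (Raise.preserves-cong 1ℤ g≈0 a) (Raise.preserves-0 1ℤ a))) (ℤₚ.+-identityʳ _))) (sum≈0 a)
    contradict : ¬ NonZeroVec (x ∷ xs)
    contradict (here x≢0) = f≉0 λ a → [ (λ x≡0 → ⊥-elim (x≢0 x≡0)) , (λ z → z) ]′ (ℤₚ.i*j≡0⇒i≡0∨j≡0 x (scaled a))
    contradict (there nz) = indicators-independent (monomials-unique (suc k) d n) xs g≈0 nz

-- Products of elements of the kernel of lower

antidiagonal : (ℕ → ℕ → ℤ) → ℕ → ℤ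
antidiagonal h zero    = h 0 0
antidiagonal h (suc n) = h 0 (suc n) ℤ.+ antidiagonal (λ i j → h (suc i) j) n

antidiagonal-cong : ∀ {h h′ : ℕ → ℕ → ℤ} n → (∀ i j → i + j ≡ n → h i j ≡ h′ i j) → antidiagonal h n ≡ antidiagonal h′ n
antidiagonal-cong zero    eq = eq 0 0 refl
antidiagonal-cong (suc n) eq = cong₂ ℤ._+_ (eq 0 (suc n) refl) (antidiagonal-cong n (λ i j e → eq (suc i) j (cong suc e)))

antidiagonal-0 : ∀ n → antidiagonal (λ _ _ → 0ℤ) n ≡ 0ℤ
antidiagonal-0 zero    = refl
antidiagonal-0 (suc n) = cong (λ z → 0ℤ ℤ.+ z) (antidiagonal-0 n)

antidiagonal-+ : ∀ (h h′ : ℕ → ℕ → ℤ) n →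
  antidiagonal (λ i j → h i j ℤ.+ h′ i j) n ≡ antidiagonal h n ℤ.+ antidiagonal h′ n
antidiagonal-+ h h′ zero    = refl
antidiagonal-+ h h′ (suc n) = trans
  (cong (λ z → h 0 (suc n) ℤ.+ h′ 0 (suc n) ℤ.+ z) (antidiagonal-+ (λ i → h (suc i)) (λ i → h′ (suc i)) n))
  (+-interchange (h 0 (suc n)) (h′ 0 (suc n)) _ _)

antidiagonal-* : ∀ x (h : ℕ → ℕ → ℤ) n → antidiagonal (λ i j → x ℤ.* h i j) n ≡ x ℤ.* antidiagonal h n
antidiagonal-* x h zero    = refl
antidiagonal-* x h (suc n) = trans (cong (λ z → x ℤ.* h 0 (suc n) ℤ.+ z) (antidiagonal-* x (λ i → h (suc i)) n))
  (sym (ℤₚ.*-distribˡ-+ x (h 0 (suc n)) _))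

antidiagonal-last : ∀ (h : ℕ → ℕ → ℤ) n →
  antidiagonal h (suc n) ≡ antidiagonal (λ i j → h i (suc j)) n ℤ.+ h (suc n) 0
antidiagonal-last h zero    = refl
antidiagonal-last h (suc n) = trans (cong (λ z → h 0 (suc (suc n)) ℤ.+ z) (antidiagonal-last (λ i → h (suc i)) n))
  (sym (ℤₚ.+-assoc (h 0 (suc (suc n))) _ _))

-- The Leibniz rule in one variable: on the antidiagonal the factor n + 1 equals i + j, and the
-- terms with i = 0 or j = 0 drop out of the respective sum.
antidiagonal-suc : ∀ (h : ℕ → ℕ → ℤ) n → + suc n ℤ.* antidiagonal h (suc n) ≡
  antidiagonal (λ i j → + suc i ℤ.* h (suc i) j) n ℤ.+ antidiagonal (λ i j → + suc j ℤ.* h i (suc j)) n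
antidiagonal-suc h n = begin
  + suc n ℤ.* antidiagonal h (suc n)
    ≡⟨ sym (antidiagonal-* (+ suc n) h (suc n)) ⟩
  antidiagonal (λ i j → + suc n ℤ.* h i j) (suc n)
    ≡⟨ antidiagonal-cong (suc n) (λ i j e → trans (cong (λ m → + m ℤ.* h i j) (sym e)) (ℤₚ.*-distribʳ-+ (h i j) (+ i) (+ j))) ⟩
  antidiagonal (λ i j → + i ℤ.* h i j ℤ.+ + j ℤ.* h i j) (suc n)
    ≡⟨ antidiagonal-+ (λ i j → + i ℤ.* h i j) (λ i j → + j ℤ.* h i j) (suc n) ⟩
  antidiagonal (λ i j → + i ℤ.* h i j) (suc n) ℤ.+ antidiagonal (λ i j → + j ℤ.* h i j) (suc n)
    ≡⟨ cong₂ ℤ._+_ (ℤₚ.+-identityˡ (antidiagonal (λ i j → + suc i ℤ.* h (suc i) j) n))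
        (trans (antidiagonal-last (λ i j → + j ℤ.* h i j) n) (ℤₚ.+-identityʳ (antidiagonal (λ i j → + suc j ℤ.* h i (suc j)) n))) ⟩
  antidiagonal (λ i j → + suc i ℤ.* h (suc i) j) n ℤ.+ antidiagonal (λ i j → + suc j ℤ.* h i (suc j)) n ∎
  where open ≡-Reasoning

linear-antidiagonal : ∀ {X Y : Set} {L : (X → ℤ) → Y → ℤ} → Linear L → ∀ (h : ℕ → ℕ → X → ℤ) n a →
  L (λ b → antidiagonal (λ i j → h i j b) n) a ≡ antidiagonal (λ i j → L (h i j) a) n
linear-antidiagonal lin h zero    a = refl
linear-antidiagonal {L = L} lin h (suc n) a =
  trans (Linear.preserves-+ lin (h 0 (suc n)) _ a) (cong (λ z → L (h 0 (suc n)) a ℤ.+ z) (linear-antidiagonal lin (λ i → h (suc i)) n a))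

infixl 7 _⊛_
_⊛_ : ∀ {k} → Poly k → Poly k → Poly k
(f ⊛ g) []      = f [] ℤ.* g []
(f ⊛ g) (n ∷ a) = antidiagonal (λ i j → ((λ b → f (i ∷ b)) ⊛ (λ b → g (j ∷ b))) a) n

⊛-cong : ∀ {k} {f f′ g g′ : Poly k} → f ≈ f′ → g ≈ g′ → f ⊛ g ≈ f′ ⊛ g′
⊛-cong p q []      = cong₂ ℤ._*_ (p []) (q [])
⊛-cong p q (n ∷ a) = antidiagonal-cong n (λ i j _ → ⊛-cong (p ∘ (i ∷_)) (q ∘ (j ∷_)) a)

⊛-linearˡ : ∀ {k} (g : Poly k) → Linear (_⊛ g)
⊛-linearˡ g = record
  { preserves-cong = λ p → ⊛-cong p (λ _ → refl)
  ; preserves-0 = ⊛-0 g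
  ; preserves-+ = λ f f′ → ⊛-+ f f′ g
  ; preserves-* = λ x f → ⊛-* x f g
  }
  where
  ⊛-0 : ∀ {k} (g : Poly k) → zeroPoly ⊛ g ≈ zeroPoly
  ⊛-0 g []      = refl
  ⊛-0 g (n ∷ a) = trans (antidiagonal-cong n (λ i j _ → ⊛-0 (g ∘ (j ∷_)) a)) (antidiagonal-0 n)
  ⊛-+ : ∀ {k} (f f′ g : Poly k) a → ((λ b → f b ℤ.+ f′ b) ⊛ g) a ≡ (f ⊛ g) a ℤ.+ (f′ ⊛ g) a
  ⊛-+ f f′ g []      = ℤₚ.*-distribʳ-+ (g []) (f []) (f′ [])
  ⊛-+ f f′ g (n ∷ a) = trans (antidiagonal-cong n (λ i j _ → ⊛-+ (f ∘ (i ∷_)) (f′ ∘ (i ∷_)) (g ∘ (j ∷_)) a))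
    (antidiagonal-+ _ _ n)
  ⊛-* : ∀ {k} x (f g : Poly k) a → ((λ b → x ℤ.* f b) ⊛ g) a ≡ x ℤ.* (f ⊛ g) a
  ⊛-* x f g []      = ℤₚ.*-assoc x (f []) (g [])
  ⊛-* x f g (n ∷ a) = trans (antidiagonal-cong n (λ i j _ → ⊛-* x (f ∘ (i ∷_)) (g ∘ (j ∷_)) a))
    (antidiagonal-* x _ n)

⊛-linearʳ : ∀ {k} (f : Poly k) → Linear (f ⊛_)
⊛-linearʳ f = record
  { preserves-cong = λ p → ⊛-cong {f = f} (λ _ → refl) p
  ; preserves-0 = ⊛-0 f
  ; preserves-+ = ⊛-+ f
  ; preserves-* = λ x → ⊛-* x f
  }
  where
  ⊛-0 : ∀ {k} (f : Poly k) → f ⊛ zeroPoly ≈ zeroPoly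
  ⊛-0 f []      = ℤₚ.*-zeroʳ (f [])
  ⊛-0 f (n ∷ a) = trans (antidiagonal-cong n (λ i j _ → ⊛-0 (f ∘ (i ∷_)) a)) (antidiagonal-0 n)
  ⊛-+ : ∀ {k} (f g g′ : Poly k) a → (f ⊛ (λ b → g b ℤ.+ g′ b)) a ≡ (f ⊛ g) a ℤ.+ (f ⊛ g′) a
  ⊛-+ f g g′ []      = ℤₚ.*-distribˡ-+ (f []) (g []) (g′ [])
  ⊛-+ f g g′ (n ∷ a) = trans (antidiagonal-cong n (λ i j _ → ⊛-+ (f ∘ (i ∷_)) (g ∘ (j ∷_)) (g′ ∘ (j ∷_)) a))
    (antidiagonal-+ _ _ n)
  ⊛-* : ∀ {k} x (f g : Poly k) a → (f ⊛ (λ b → x ℤ.* g b)) a ≡ x ℤ.* (f ⊛ g) a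
  ⊛-* x f g []      = *-left-comm (f []) x (g [])
  ⊛-* x f g (n ∷ a) = trans (antidiagonal-cong n (λ i j _ → ⊛-* x (f ∘ (i ∷_)) (g ∘ (j ∷_)) a))
    (antidiagonal-* x _ n)

module ⊛ˡ {k} g = Linear (⊛-linearˡ {k} g)
module ⊛ʳ {k} f = Linear (⊛-linearʳ {k} f)

diffHead-linear : ∀ {k} → Linear (diffHead {k})
diffHead-linear = record
  { preserves-cong = diffHead-cong
  ; preserves-0 = diffHead-0
  ; preserves-+ = diffHead-+
  ; preserves-* = diffHead-*
  }

diffHead-⊛ : ∀ {k} (f g : Poly (suc k)) a → diffHead (f ⊛ g) a ≡ (diffHead f ⊛ g) a ℤ.+ (f ⊛ diffHead g) a
diffHead-⊛ f g (n ∷ a) = trans (antidiagonal-suc (λ i j → ((λ b → f (i ∷ b)) ⊛ (λ b → g (j ∷ b))) a) n)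
  (cong₂ ℤ._+_
    (antidiagonal-cong n (λ i j _ → sym (⊛ˡ.preserves-* (λ b → g (j ∷ b)) (+ suc i) (λ b → f (suc i ∷ b)) a)))
    (antidiagonal-cong n (λ i j _ → sym (⊛ʳ.preserves-* (λ b → f (i ∷ b)) (+ suc j) (λ b → g (suc j ∷ b)) a))))

lowerHead-⊛ : ∀ {k} (f g : Poly (suc (suc k))) a → lowerHead (f ⊛ g) a ≡ (lowerHead f ⊛ g) a ℤ.+ (f ⊛ lowerHead g) a
lowerHead-⊛ f g (zero ∷ b) = sym (cong₂ ℤ._+_ (⊛ˡ.preserves-0 (λ c → g (0 ∷ c)) b) (⊛ʳ.preserves-0 (λ c → f (0 ∷ c)) b))
lowerHead-⊛ {k} f g (suc n ∷ b) = begin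
  diffHead (λ c → (f ⊛ g) (n ∷ c)) b
    ≡⟨ linear-antidiagonal diffHead-linear (λ i j → F i ⊛ G j) n b ⟩
  antidiagonal (λ i j → diffHead (F i ⊛ G j) b) n
    ≡⟨ antidiagonal-cong n (λ i j _ → diffHead-⊛ (F i) (G j) b) ⟩
  antidiagonal (λ i j → (diffHead (F i) ⊛ G j) b ℤ.+ (F i ⊛ diffHead (G j)) b) n
    ≡⟨ antidiagonal-+ (λ i j → (diffHead (F i) ⊛ G j) b) (λ i j → (F i ⊛ diffHead (G j)) b) n ⟩
  antidiagonal (λ i j → (diffHead (F i) ⊛ G j) b) n ℤ.+ antidiagonal (λ i j → (F i ⊛ diffHead (G j)) b) n
    -- The products on the right have one term more than these sums; the extra terms are zero
    -- because `lowerHead` vanishes at exponent 0.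
    ≡⟨ cong₂ ℤ._+_
        (sym (trans (cong (ℤ._+ antidiagonal (λ i j → (diffHead (F i) ⊛ G j) b) n) (⊛ˡ.preserves-0 (G (suc n)) b)) (ℤₚ.+-identityˡ (antidiagonal (λ i j → (diffHead (F i) ⊛ G j) b) n))))
        (sym (trans (antidiagonal-last (λ i j → (F i ⊛ (λ c → lowerHead g (j ∷ c))) b) n)
          (trans (cong (λ z → antidiagonal (λ i j → (F i ⊛ diffHead (G j)) b) n ℤ.+ z) (⊛ʳ.preserves-0 (F (suc n)) b)) (ℤₚ.+-identityʳ (antidiagonal (λ i j → (F i ⊛ diffHead (G j)) b) n))))) ⟩
  (lowerHead f ⊛ g) (suc n ∷ b) ℤ.+ (f ⊛ lowerHead g) (suc n ∷ b) ∎
  where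
  open ≡-Reasoning
  F : ℕ → Poly (suc k)
  F i c = f (i ∷ c)
  G : ℕ → Poly (suc k)
  G j c = g (j ∷ c)

lower-⊛ : ∀ {k} (f g : Poly k) a → lower (f ⊛ g) a ≡ (lower f ⊛ g) a ℤ.+ (f ⊛ lower g) a
lower-⊛ f g []           = sym (cong (λ z → 0ℤ ℤ.+ z) (ℤₚ.*-zeroʳ (f [])))
lower-⊛ {suc zero} f g (n ∷ []) = sym (cong₂ ℤ._+_
  (trans (antidiagonal-cong n (λ i j _ → refl)) (antidiagonal-0 n))
  (trans (antidiagonal-cong n (λ i j _ → ℤₚ.*-zeroʳ (f (i ∷ [])))) (antidiagonal-0 n)))
lower-⊛ {suc (suc k)} f g (n ∷ m ∷ a) = begin
  lowerHead (f ⊛ g) (n ∷ b) ℤ.+ lower (λ c → (f ⊛ g) (n ∷ c)) b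
    ≡⟨ cong₂ ℤ._+_ (lowerHead-⊛ f g (n ∷ b)) (trans (linear-antidiagonal lower-linear (λ i j → F i ⊛ G j) n b)
        (trans (antidiagonal-cong n (λ i j _ → lower-⊛ (F i) (G j) b))
          (antidiagonal-+ (λ i j → (lower (F i) ⊛ G j) b) (λ i j → (F i ⊛ lower (G j)) b) n))) ⟩
  ((lowerHead f ⊛ g) (n ∷ b) ℤ.+ (f ⊛ lowerHead g) (n ∷ b)) ℤ.+
    (antidiagonal (λ i j → (lower (F i) ⊛ G j) b) n ℤ.+ antidiagonal (λ i j → (F i ⊛ lower (G j)) b) n)
    ≡⟨ +-interchange ((lowerHead f ⊛ g) (n ∷ b)) _ _ _ ⟩
  ((lowerHead f ⊛ g) (n ∷ b) ℤ.+ antidiagonal (λ i j → (lower (F i) ⊛ G j) b) n) ℤ.+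
    ((f ⊛ lowerHead g) (n ∷ b) ℤ.+ antidiagonal (λ i j → (F i ⊛ lower (G j)) b) n)
    ≡⟨ cong₂ ℤ._+_
        (sym (trans (antidiagonal-cong n (λ i j _ → trans (⊛-cong {g = G j} (unfold f i) (λ _ → refl) b)
            (⊛ˡ.preserves-+ (G j) (λ c → lowerHead f (i ∷ c)) (lower (F i)) b)))
          (antidiagonal-+ (λ i j → ((λ c → lowerHead f (i ∷ c)) ⊛ G j) b) _ n)))
        (sym (trans (antidiagonal-cong n (λ i j _ → trans (⊛-cong {f = F i} (λ _ → refl) (unfold g j) b)
            (⊛ʳ.preserves-+ (F i) (λ c → lowerHead g (j ∷ c)) (lower (G j)) b)))
          (antidiagonal-+ (λ i j → (F i ⊛ (λ c → lowerHead g (j ∷ c))) b) _ n))) ⟩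
  (lower f ⊛ g) (n ∷ b) ℤ.+ (f ⊛ lower g) (n ∷ b) ∎
  where
  open ≡-Reasoning
  b = m ∷ a
  F : ℕ → Poly (suc k)
  F i c = f (i ∷ c)
  G : ℕ → Poly (suc k)
  G j c = g (j ∷ c)
  unfold : ∀ (f : Poly (suc (suc k))) i c → lower f (i ∷ c) ≡ lowerHead f (i ∷ c) ℤ.+ lower (λ e → f (i ∷ e)) c
  unfold f i (m ∷ a) = refl

⊛-local : ∀ {k} (f g : Poly k) a → (∀ b c → Vec.zipWith _+_ b c ≡ a → f b ℤ.* g c ≡ 0ℤ) → (f ⊛ g) a ≡ 0ℤ
⊛-local f g []      h = h [] [] refl
⊛-local f g (n ∷ a) h = trans (antidiagonal-cong n (λ i j e →
    ⊛-local (f ∘ (i ∷_)) (g ∘ (j ∷_)) a (λ b c e′ → h (i ∷ b) (j ∷ c) (cong₂ _∷_ e e′))))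
  (antidiagonal-0 n)

degree-+ : ∀ {k} (a b : Mon k) → degree (Vec.zipWith _+_ a b) ≡ degree a + degree b
degree-+ []      []      = refl
degree-+ (m ∷ a) (n ∷ b) = trans (cong (λ z → m + n + z) (degree-+ a b)) (interchange m n (degree a) (degree b))
  where
  interchange : ∀ m n x y → m + n + (x + y) ≡ m + x + (n + y)
  interchange = ℕSolver.solve-∀

weight-+ : ∀ {k} (a b : Mon k) → weight (Vec.zipWith _+_ a b) ≡ weight a + weight b
weight-+ []      []      = refl
weight-+ (m ∷ a) (n ∷ b) = trans (cong₂ _+_ (degree-+ a b) (weight-+ a b))
  (interchange (degree a) (degree b) (weight a) (weight b))
  where
  interchange : ∀ m n x y → m + n + (x + y) ≡ m + x + (n + y)
  interchange = ℕSolver.solve-∀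

⊛-supported : ∀ {k d e m n} {f g : Poly k} → Supported d m f → Supported e n g → Supported (d + e) (m + n) (f ⊛ g)
⊛-supported {d = d} {e} {m} {n} {f} {g} suppf suppg a ¬of = ⊛-local f g a split
  where
  split : ∀ b c → Vec.zipWith _+_ b c ≡ a → f b ℤ.* g c ≡ 0ℤ
  split b c refl with of? d m b | of? e n c
  ... | no ¬ofb | _       = cong (ℤ._* g c) (suppf b ¬ofb)
  ... | yes _   | no ¬ofc = trans (cong (f b ℤ.*_) (suppg c ¬ofc)) (ℤₚ.*-zeroʳ (f b))
  ... | yes (refl , refl) | yes (refl , refl) = ⊥-elim (¬of (degree-+ b c , weight-+ b c))

-- Any other pair with sum i + j has a first entry below `i` or a second entry below `j`; this
-- isolates the lowest term of a product.
antidiagonal-corner : ∀ {h : ℕ → ℕ → ℤ} i j →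
  (∀ i′ j′ → i′ < i → h i′ j′ ≡ 0ℤ) → (∀ i′ j′ → j′ < j → h i′ j′ ≡ 0ℤ) → antidiagonal h (i + j) ≡ h i j
antidiagonal-corner zero zero    left right = refl
antidiagonal-corner {h} zero (suc j) left right = trans
  (cong (λ z → h 0 (suc j) ℤ.+ z) (trans (antidiagonal-cong j (λ i j′ e → right (suc i) j′ (s≤s (m+n≤o⇒n≤o i (≤-reflexive e)))))
    (antidiagonal-0 j)))
  (ℤₚ.+-identityʳ _)
antidiagonal-corner {h} (suc i) j left right = trans
  (cong₂ ℤ._+_ (left 0 (suc (i + j)) (s≤s z≤n))
    (antidiagonal-corner i j (λ i′ j′ l → left (suc i′) j′ (s≤s l)) (λ i′ j′ → right (suc i′) j′)))
  (ℤₚ.+-identityˡ _)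

-- The least index with f i ≉ 0 exists only up to double negation, f being a power series.
least-nontrivial : ∀ {k} (f : Poly (suc k)) → ¬ f ≈ zeroPoly →
  ¬ ¬ (Σ[ i ∈ ℕ ] (¬ (λ b → f (i ∷ b)) ≈ zeroPoly × (∀ i′ b → i′ < i → f (i′ ∷ b) ≡ 0ℤ)))
least-nontrivial f f≉0 none = f≉0 λ { (i ∷ b) → allZero i b }
  where
  allZero : ∀ i → (λ b → f (i ∷ b)) ≈ zeroPoly
  allZero = <-rec _ λ i below b → zero-stable b λ fb≢0 → none (i , (λ z → fb≢0 (z b)) , λ i′ b l → below {i′} l b)
    where
    zero-stable : ∀ {i} b → ¬ ¬ f (i ∷ b) ≡ 0ℤ → f (i ∷ b) ≡ 0ℤ
    zero-stable {i} b nn with f (i ∷ b) ℤ.≟ 0ℤ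
    ... | yes eq = eq
    ... | no neq = ⊥-elim (nn neq)

-- The slices of lowest exponent in x₀ multiply to the lowest slice of the product, which is nonzero
-- by induction on the number of variables. The goal is a negation, so the double negation in
-- `least-nontrivial` does no harm.
⊛-nontrivial : ∀ {k} (f g : Poly k) → ¬ f ≈ zeroPoly → ¬ g ≈ zeroPoly → ¬ (f ⊛ g) ≈ zeroPoly
⊛-nontrivial {zero}  f g f≉0 g≉0 h = *-nontrivial (λ z → f≉0 λ { [] → z }) (λ z → g≉0 λ { [] → z }) (h [])
⊛-nontrivial {suc k} f g f≉0 g≉0 h =
  least-nontrivial f f≉0 λ { (i , fi≉0 , f<i) →
  least-nontrivial g g≉0 λ { (j , gj≉0 , g<j) →
  ⊛-nontrivial (λ b → f (i ∷ b)) (λ b → g (j ∷ b)) fi≉0 gj≉0 λ a →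
    trans (sym (antidiagonal-corner {λ i j → ((λ b → f (i ∷ b)) ⊛ (λ b → g (j ∷ b))) a} i j
      (λ i′ j′ l → trans (⊛ˡ.preserves-cong (λ b → g (j′ ∷ b)) (λ b → f<i i′ b l) a) (⊛ˡ.preserves-0 (λ b → g (j′ ∷ b)) a))
      (λ i′ j′ l → trans (⊛ʳ.preserves-cong (λ b → f (i′ ∷ b)) (λ b → g<j j′ b l) a) (⊛ʳ.preserves-0 (λ b → f (i′ ∷ b)) a))))
      (h (i + j ∷ a)) } }

kernel-⊛ : ∀ {k d e m n} → LowerKernel k d m → LowerKernel k e n → LowerKernel k (d + e) (m + n)
kernel-⊛ (f , suppf , f≉0 , kerf) (g , suppg , g≉0 , kerg) =
  f ⊛ g , ⊛-supported suppf suppg , ⊛-nontrivial f g f≉0 g≉0 , λ a → trans (lower-⊛ f g a) (cong₂ ℤ._+_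
    (trans (⊛ˡ.preserves-cong g kerf a) (⊛ˡ.preserves-0 g a))
    (trans (⊛ʳ.preserves-cong f kerg a) (⊛ʳ.preserves-0 f a)))

-- Ascents become kernel elements, which are multiplied; the bound keeps the total weight in the
-- lower half, where the product yields an ascent again.
ascent-+ : ∀ {ℓ d e m n} → Ascent (suc ℓ) d m → Ascent (suc ℓ) e n → 1 ≤ m + n → 2 * (m + n) ≤ ℓ * (d + e) →
  Ascent (suc ℓ) (d + e) (m + n)
ascent-+ {ℓ} {d} {e} {m} {n} p q 1≤ bound = positive (m + n) 1≤ bound (kernel-⊛ (ascent⇒kernel {d = d} {m} p) (ascent⇒kernel {d = e} {n} q))
  where
  positive : ∀ s → 1 ≤ s → 2 * s ≤ ℓ * (d + e) → LowerKernel (suc ℓ) (d + e) s → Ascent (suc ℓ) (d + e) s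
  positive (suc s) _ bound = kernel⇒ascent (<-≤-trans (*-monoʳ-< 2 ≤-refl) bound)

-- The narrow rectangles ℓ = 2, 3, 4

Stationary : ℕ → ℕ → ℕ → Set
Stationary ℓ m n = count (suc ℓ) m (suc n) ≡ count (suc ℓ) m n

count-split : ∀ k d {n} r → n ≡ suc d + r → count (suc k) (suc d) n ≡ count (suc k) d n + count k (suc d) r
count-split k d r refl = cong (λ z → count (suc k) d (suc d + r) + z) (shift-≥ (suc d) (count k (suc d)) r)

count-stable : ∀ k d {n} → n ≤ d → count (suc k) (suc d) n ≡ count (suc k) d n
count-stable k d n≤d = trans (cong (λ z → count (suc k) d _ + z) (shift-< (suc d) (count k (suc d)) (s≤s n≤d))) (+-identityʳ _)

count-twoVariables : ∀ d n → n ≤ d → count 2 d n ≡ 1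
count-twoVariables zero    zero    z≤n = refl
count-twoVariables (suc d) zero    z≤n = trans (count-lastVariable 1 d 0) (cong (_+ 0) (count-oneVariable (suc d) 0))
count-twoVariables (suc d) (suc n) (s≤s h) = trans (count-lastVariable 1 d (suc n))
  (cong₂ _+_ (count-oneVariable (suc d) (suc n)) (count-twoVariables d n h))

count-threeVariables : ∀ d n → n ≤ d → count 3 d n ≡ suc ⌊ n /2⌋
count-threeVariables zero    zero          z≤n = refl
count-threeVariables (suc d) zero          h = trans (count-lastVariable 2 d 0) (cong (_+ 0) (count-twoVariables (suc d) 0 h))
count-threeVariables (suc d) (suc zero)    h = trans (count-lastVariable 2 d 1) (cong (_+ 0) (count-twoVariables (suc d) 1 h))
count-threeVariables (suc d) (suc (suc n)) h = trans (count-lastVariable 2 d (2 + n))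
  (cong₂ _+_ (count-twoVariables (suc d) (2 + n) h) (count-threeVariables d n (≤-trans (n≤1+n n) (≤-pred h))))

stationary-2 : ∀ m → 3 ≤ m → Stationary 2 m 2
stationary-2 m h = trans (count-threeVariables m 3 h) (sym (count-threeVariables m 2 (≤-trans (n≤1+n 2) h)))

-- A binary cubic has no covariant of odd degree and order 1.
stationary-3-odd : ∀ j → Stationary 3 (1 + 2 * j) (3 * j)

-- Removing the first variable leaves degree 1 + 2j at weights 3 + 3j and 2 + 3j, which reflect to
-- 3j and 1 + 3j and agree by `stationary-3-odd`. Only the difference of two three-variable counts
-- remains. This lemma and `stationary-3-odd` are proved by a common induction.
balance-3 : ∀ j → count 4 (2 + 2 * j) (3 + 3 * j) + count 3 (2 + 2 * j) j ≡
  count 4 (2 + 2 * j) (2 + 3 * j) + count 3 (2 + 2 * j) (1 + j)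
balance-3 j = begin
  c (2 + 2 * j) (3 + 3 * j) + b j                ≡⟨ cong (_+ b j) (count-split 3 (1 + 2 * j) (1 + j) (index₁ j)) ⟩
  c (1 + 2 * j) (3 + 3 * j) + b (1 + j) + b j
    ≡⟨ cong (λ z → z + b (1 + j) + b j) (trans (count-reflect 3 (1 + 2 * j) (3 + 3 * j) (3 * j) (sum₁ j))
        (trans (sym (stationary-3-odd j)) (count-reflect 3 (1 + 2 * j) (1 + 3 * j) (2 + 3 * j) (sum₂ j)))) ⟩
  c (1 + 2 * j) (2 + 3 * j) + b (1 + j) + b j    ≡⟨ exchange (c (1 + 2 * j) (2 + 3 * j)) (b (1 + j)) (b j) ⟩
  c (1 + 2 * j) (2 + 3 * j) + b j + b (1 + j)    ≡⟨ cong (_+ b (1 + j)) (sym (count-split 3 (1 + 2 * j) j (index₂ j))) ⟩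
  c (2 + 2 * j) (2 + 3 * j) + b (1 + j)          ∎
  where
  open ≡-Reasoning
  c = count 4
  b = count 3 (2 + 2 * j)
  index₁ : ∀ j → 3 + 3 * j ≡ 2 + 2 * j + (1 + j)
  index₁ = ℕSolver.solve-∀
  index₂ : ∀ j → 2 + 3 * j ≡ 2 + 2 * j + j
  index₂ = ℕSolver.solve-∀
  sum₁ : ∀ j → 3 + 3 * j + 3 * j ≡ 3 * (1 + 2 * j)
  sum₁ = ℕSolver.solve-∀
  sum₂ : ∀ j → 1 + 3 * j + (2 + 3 * j) ≡ 3 * (1 + 2 * j)
  sum₂ = ℕSolver.solve-∀
  exchange : ∀ x y z → x + y + z ≡ x + z + y
  exchange = ℕSolver.solve-∀

stationary-3-odd zero    = refl
-- The first variable is removed once more: degree 2 + 2j is left at weights 4 + 3j and 3 + 3j, and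
-- reflecting the former to 2 + 3j produces exactly the pair in `balance-3`.
stationary-3-odd (suc j) = subst₂ (λ m n → Stationary 3 m n) (degreeEq j) (weightEq j) (begin
  c (3 + 2 * j) (4 + 3 * j)                    ≡⟨ count-split 3 (2 + 2 * j) (1 + j) (index₁ j) ⟩
  c (2 + 2 * j) (4 + 3 * j) + b (3 + 2 * j) (1 + j)
    ≡⟨ cong₂ _+_ (count-reflect 3 (2 + 2 * j) (4 + 3 * j) (2 + 3 * j) (sum j)) (count-stable 2 (2 + 2 * j) (bound j)) ⟩
  c (2 + 2 * j) (2 + 3 * j) + b (2 + 2 * j) (1 + j)   ≡⟨ sym (balance-3 j) ⟩
  c (2 + 2 * j) (3 + 3 * j) + b (2 + 2 * j) j
    ≡⟨ cong (λ z → c (2 + 2 * j) (3 + 3 * j) + z) (sym (count-stable 2 (2 + 2 * j) (≤-trans (n≤1+n j) (bound j)))) ⟩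
  c (2 + 2 * j) (3 + 3 * j) + b (3 + 2 * j) j         ≡⟨ sym (count-split 3 (2 + 2 * j) j (index₂ j)) ⟩
  c (3 + 2 * j) (3 + 3 * j)                           ∎)
  where
  open ≡-Reasoning
  c = count 4
  b = count 3
  degreeEq : ∀ j → 3 + 2 * j ≡ 1 + 2 * suc j
  degreeEq = ℕSolver.solve-∀
  weightEq : ∀ j → 3 + 3 * j ≡ 3 * suc j
  weightEq = ℕSolver.solve-∀
  index₁ : ∀ j → 4 + 3 * j ≡ 3 + 2 * j + (1 + j)
  index₁ = ℕSolver.solve-∀
  index₂ : ∀ j → 3 + 3 * j ≡ 3 + 2 * j + j
  index₂ = ℕSolver.solve-∀
  sum : ∀ j → 4 + 3 * j + (2 + 3 * j) ≡ 3 * (2 + 2 * j)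
  sum = ℕSolver.solve-∀
  bound : ∀ j → 1 + j ≤ 2 + 2 * j
  bound j = s≤s (≤-trans (m≤m+n j (j + 0)) (n≤1+n _))

half-even : ∀ i → ⌊ 2 * i /2⌋ ≡ i
half-even i = trans (cong (λ z → ⌊ i + z /2⌋) (+-identityʳ i)) (sym (n≡⌊n+n/2⌋ i))

half-odd : ∀ i → ⌊ 1 + 2 * i /2⌋ ≡ i
half-odd zero    = refl
half-odd (suc i) = trans (cong ⌊_/2⌋ (double i)) (cong suc (half-odd i))
  where
  double : ∀ i → 1 + 2 * suc i ≡ 2 + (1 + 2 * i)
  double = ℕSolver.solve-∀

count-threeVariables-even : ∀ d i → 1 + 2 * i ≤ d → count 3 d (1 + 2 * i) ≡ count 3 d (2 * i)
count-threeVariables-even d i h = trans (count-threeVariables d (1 + 2 * i) h)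
  (trans (cong suc (trans (half-odd i) (sym (half-even i)))) (sym (count-threeVariables d (2 * i) (≤-trans (n≤1+n _) h))))

-- Here `j` is even, so partitions of j and of j + 1 into at most two parts are equally many and
-- cancel from `balance-3`. The plateau ends at the middle.
stationary-3-2mod4 : ∀ i → let j = 2 * i in Stationary 3 (2 + 2 * j) (2 + 3 * j)
stationary-3-2mod4 i = +-cancelʳ-≡ (count 3 (2 + 2 * j) j) _ _
  (trans (balance-3 j) (cong (λ z → count 4 (2 + 2 * j) (2 + 3 * j) + z)
    (count-threeVariables-even (2 + 2 * j) i (s≤s (≤-trans (m≤m+n j (j + 0)) (n≤1+n _))))))
  where j = 2 * i

-- Powers of the discriminant, an invariant of degree 4, make the last step to the middle 6 + 3j a
-- strict one, so the plateau must be sought one step lower. There the terms of degree 3 + 2j are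
-- mirror images of each other.
stationary-3-0mod4 : ∀ i → let j = 2 * i in Stationary 3 (4 + 2 * j) (4 + 3 * j)
stationary-3-0mod4 i = begin
  c (4 + 2 * j) (5 + 3 * j)           ≡⟨ count-split 3 (3 + 2 * j) (1 + j) (index₁ j) ⟩
  c (3 + 2 * j) (5 + 3 * j) + b (1 + j)
    ≡⟨ cong₂ _+_ (count-reflect 3 (3 + 2 * j) (5 + 3 * j) (4 + 3 * j) (sum j)) (count-threeVariables-even (4 + 2 * j) i (bound j)) ⟩
  c (3 + 2 * j) (4 + 3 * j) + b j     ≡⟨ sym (count-split 3 (3 + 2 * j) j (index₂ j)) ⟩
  c (4 + 2 * j) (4 + 3 * j)           ∎
  where
  open ≡-Reasoning
  j = 2 * i
  c = count 4
  b = count 3 (4 + 2 * j)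
  index₁ : ∀ j → 5 + 3 * j ≡ 4 + 2 * j + (1 + j)
  index₁ = ℕSolver.solve-∀
  index₂ : ∀ j → 4 + 3 * j ≡ 4 + 2 * j + j
  index₂ = ℕSolver.solve-∀
  sum : ∀ j → 5 + 3 * j + (4 + 3 * j) ≡ 3 * (3 + 2 * j)
  sum = ℕSolver.solve-∀
  bound : ∀ j → 1 + j ≤ 4 + 2 * j
  bound j = s≤s (≤-trans (m≤m+n j (j + 0)) (m≤n+m _ 3))

-- A binary quartic has no covariant of order 2.
stationary-4 : ∀ j → Stationary 4 (1 + j) (2 * j)

-- After removing the first variable, degree `j` is left at weights 1 + 2j and 2 + 2j, just above
-- its middle 2j; for j > 0 they reflect to 2j - 1 and 2j - 2, where `stationary-4` for j - 1
-- applies.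
balance-4 : ∀ j → count 5 (1 + j) (1 + 2 * j) + count 4 (1 + j) (1 + j) ≡ count 5 (1 + j) (2 + 2 * j) + count 4 (1 + j) j
balance-4 j = begin
  c (1 + j) (1 + 2 * j) + b (1 + j)        ≡⟨ cong (_+ b (1 + j)) (count-split 4 j j (index₁ j)) ⟩
  c j (1 + 2 * j) + b j + b (1 + j)        ≡⟨ cong (λ z → z + b j + b (1 + j)) (middle j) ⟩
  c j (2 + 2 * j) + b j + b (1 + j)        ≡⟨ exchange (c j (2 + 2 * j)) (b j) (b (1 + j)) ⟩
  c j (2 + 2 * j) + b (1 + j) + b j        ≡⟨ cong (_+ b j) (sym (count-split 4 j (1 + j) (index₂ j))) ⟩
  c (1 + j) (2 + 2 * j) + b j              ∎
  where
  open ≡-Reasoning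
  c = count 5
  b = count 4 (1 + j)
  index₁ : ∀ j → 1 + 2 * j ≡ 1 + j + j
  index₁ = ℕSolver.solve-∀
  index₂ : ∀ j → 2 + 2 * j ≡ 1 + j + (1 + j)
  index₂ = ℕSolver.solve-∀
  exchange : ∀ x y z → x + y + z ≡ x + z + y
  exchange = ℕSolver.solve-∀
  middle : ∀ j → c j (1 + 2 * j) ≡ c j (2 + 2 * j)
  middle zero    = refl
  middle (suc j) = trans (count-reflect 4 (suc j) (1 + 2 * suc j) (1 + 2 * j) (sum₁ j))
    (trans (stationary-4 j) (count-reflect 4 (suc j) (2 * j) (2 + 2 * suc j) (sum₂ j)))
    where
    sum₁ : ∀ j → 1 + 2 * suc j + (1 + 2 * j) ≡ 4 * suc j
    sum₁ = ℕSolver.solve-∀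
    sum₂ : ∀ j → 2 * j + (2 + 2 * suc j) ≡ 4 * suc j
    sum₂ = ℕSolver.solve-∀

stationary-4 zero    = refl
-- Weight 3 + 2j in degree 1 + j reflects to 1 + 2j, and the four-variable counts at weights up to 1
-- + j do not change between degrees 1 + j and 2 + j; this reduces the claim to `balance-4`.
stationary-4 (suc j) = subst (Stationary 4 (2 + j)) (weightEq j) (begin
  c (2 + j) (3 + 2 * j)                          ≡⟨ count-split 4 (1 + j) (1 + j) (index₁ j) ⟩
  c (1 + j) (3 + 2 * j) + b (2 + j) (1 + j)
    ≡⟨ cong₂ _+_ (count-reflect 4 (1 + j) (3 + 2 * j) (1 + 2 * j) (sum j)) (count-stable 3 (1 + j) ≤-refl) ⟩
  c (1 + j) (1 + 2 * j) + b (1 + j) (1 + j)      ≡⟨ balance-4 j ⟩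
  c (1 + j) (2 + 2 * j) + b (1 + j) j            ≡⟨ cong (λ z → c (1 + j) (2 + 2 * j) + z) (sym (count-stable 3 (1 + j) (n≤1+n j))) ⟩
  c (1 + j) (2 + 2 * j) + b (2 + j) j            ≡⟨ sym (count-split 4 (1 + j) j (index₂ j)) ⟩
  c (2 + j) (2 + 2 * j)                          ∎)
  where
  open ≡-Reasoning
  c = count 5
  b = count 4
  weightEq : ∀ j → 2 + 2 * j ≡ 2 * suc j
  weightEq = ℕSolver.solve-∀
  index₁ : ∀ j → 3 + 2 * j ≡ 2 + j + (1 + j)
  index₁ = ℕSolver.solve-∀
  index₂ : ∀ j → 2 + 2 * j ≡ 2 + j + j
  index₂ = ℕSolver.solve-∀
  sum : ∀ j → 3 + 2 * j + (1 + 2 * j) ≡ 4 * (1 + j)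
  sum = ℕSolver.solve-∀

-- Computation of Gaussian coefficients

coefficient : List ℕ → ℕ → ℕ
coefficient []       n       = 0
coefficient (x ∷ xs) zero    = x
coefficient (x ∷ xs) (suc n) = coefficient xs n

add : List ℕ → List ℕ → List ℕ
add []       ys       = ys
add (x ∷ xs) []       = x ∷ xs
add (x ∷ xs) (y ∷ ys) = x + y ∷ add xs ys

multiplyPower : ℕ → List ℕ → List ℕ
multiplyPower zero    xs = xs
multiplyPower (suc s) xs = 0 ∷ multiplyPower s xs

coefficient-add : ∀ xs ys n → coefficient (add xs ys) n ≡ coefficient xs n + coefficient ys n
coefficient-add []       ys       n       = refl
coefficient-add (x ∷ xs) []       n       = sym (+-identityʳ _)
coefficient-add (x ∷ xs) (y ∷ ys) zero    = refl
coefficient-add (x ∷ xs) (y ∷ ys) (suc n) = coefficient-add xs ys n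

coefficient-multiplyPower : ∀ s xs n → coefficient (multiplyPower s xs) n ≡ shift 0 s (coefficient xs) n
coefficient-multiplyPower zero    xs n       = refl
coefficient-multiplyPower (suc s) xs zero    = refl
coefficient-multiplyPower (suc s) xs (suc n) = coefficient-multiplyPower s xs n

nextRow : ∀ {M} → ℕ → List ℕ → Vec (List ℕ) M → Vec (List ℕ) M
-- The new entry is passed as an argument so that evaluation shares it.
appendEntry : ∀ {M} → ℕ → List ℕ → Vec (List ℕ) M → Vec (List ℕ) (suc M)
nextRow d acc []       = []
nextRow d acc (q ∷ qs) = appendEntry d (add acc (multiplyPower (suc d) q)) qs
appendEntry d r qs = r ∷ nextRow (suc d) r qs

-- Entry `d` lists the coefficients of the Gaussian polynomial for `k` variables and degree `d`.
-- Evaluating `count` would solve the same subproblems repeatedly; here each polynomial is built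
-- once from its two Pascal neighbours.
row : ∀ (k M : ℕ) → Vec (List ℕ) (suc M)
row zero    M = (1 ∷ []) ∷ Vec.replicate M []
row (suc k) M with row k M
... | q ∷ qs = q ∷ nextRow 0 q qs

final : ∀ {A : Set} {M} → Vec A (suc M) → A
final (x ∷ [])     = x
final (x ∷ y ∷ xs) = final (y ∷ xs)

gaussian : ℕ → ℕ → List ℕ
gaussian ℓ m = final (row (suc ℓ) m)

Row : ∀ {M} → ℕ → ℕ → Vec (List ℕ) M → Set
Row k d []       = ⊤
Row k d (q ∷ qs) = (∀ n → coefficient q n ≡ count k d n) × Row k (suc d) qs

nextRow-correct : ∀ {M} k d acc (qs : Vec (List ℕ) M) → (∀ n → coefficient acc n ≡ count (suc k) d n) →
  Row k (suc d) qs → Row (suc k) (suc d) (nextRow d acc qs)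
nextRow-correct k d acc []       h _        = tt
nextRow-correct k d acc (q ∷ qs) h (p , ps) = entry , nextRow-correct k (suc d) _ qs entry ps
  where
  entry : ∀ n → coefficient (add acc (multiplyPower (suc d) q)) n ≡ count (suc k) (suc d) n
  entry n = trans (coefficient-add acc _ n)
    (cong₂ _+_ (h n) (trans (coefficient-multiplyPower (suc d) q n) (shift-cong (suc d) p n)))

row-correct : ∀ k M → Row k 0 (row k M)
row-correct zero    M = (λ { zero → refl ; (suc n) → refl }) , zeros 0 M
  where
  zeros : ∀ d M → Row 0 (suc d) (Vec.replicate M [])
  zeros d zero    = tt
  zeros d (suc M) = (λ _ → refl) , zeros (suc d) M
row-correct (suc k) M with row k M | row-correct k M
... | q ∷ qs | p , ps = p , nextRow-correct k 0 q qs p ps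

final-correct : ∀ {M} k d (qs : Vec (List ℕ) (suc M)) → Row k d qs → ∀ n → coefficient (final qs) n ≡ count k (M + d) n
final-correct k d (q ∷ [])     (p , _)  = p
final-correct {suc M} k d (q ∷ r ∷ qs) (_ , ps) n =
  trans (final-correct k (suc d) (r ∷ qs) ps n) (cong (λ e → count k e n) (+-suc M d))

gaussian-correct : ∀ ℓ m n → coefficient (gaussian ℓ m) n ≡ count (suc ℓ) m n
gaussian-correct ℓ m n = trans (final-correct (suc ℓ) 0 (row (suc ℓ) m) (row-correct (suc ℓ) m) n)
  (cong (λ e → count (suc ℓ) e n) (+-identityʳ m))

-- Stated with a strict bound on an implicit index, the form that `allUpTo?` decides.
Rises : ℕ → List ℕ → Set
Rises N g = ∀ {n} → n < suc ⌊ N /2⌋ → 2 ≤ n → coefficient g (n ∸ 1) < coefficient g n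

rises? : ∀ N g → Dec (Rises N g)
rises? N g = allUpTo? (λ n → (2 ≤? n) →-dec (coefficient g (n ∸ 1) <? coefficient g n)) (suc ⌊ N /2⌋)

exceptional : ℕ → List ℕ
exceptional 5 = 6 ∷ 10 ∷ 14 ∷ []
exceptional 6 = 6 ∷ 7 ∷ 9 ∷ 11 ∷ 13 ∷ []
exceptional 7 = 10 ∷ []
exceptional _ = []

-- The largest exceptional `m` is 14, so steps of 8 can start from the eight values 15, ..., 22; the
-- smaller values are checked individually.
narrow-rises : ∀ {ℓ} → ℓ < 8 → 5 ≤ ℓ → ∀ {m} → m < 23 → ℓ ≤ m → m ∉ exceptional ℓ → Rises (ℓ * m) (gaussian ℓ m)
narrow-rises = toWitness {a? = allUpTo? (λ ℓ → (5 ≤? ℓ) →-dec allUpTo? (λ m → (ℓ ≤? m) →-dec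
  ¬? (m ∈? exceptional ℓ) →-dec rises? (ℓ * m) (gaussian ℓ m)) 23) 8} tt

-- A square of eight consecutive values in each direction, from which steps of 8 in both directions
-- reach every pair with ℓ, m ≥ 8.
wide-rises : ∀ {ℓ} → ℓ < 16 → 8 ≤ ℓ → ∀ {m} → m < 16 → 8 ≤ m → Rises (ℓ * m) (gaussian ℓ m)
wide-rises = toWitness {a? = allUpTo? (λ ℓ → (8 ≤? ℓ) →-dec allUpTo? (λ m → (8 ≤? m) →-dec
  rises? (ℓ * m) (gaussian ℓ m)) 16) 16} tt

-- Strict unimodality

Ascending : ℕ → ℕ → Set
Ascending ℓ m = ∀ n → 2 ≤ n → 2 * n ≤ ℓ * m → Ascent (suc ℓ) m n

half-≤ : ∀ {n N} → 2 * n ≤ N → n ≤ ⌊ N /2⌋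
half-≤ {n} h = subst (_≤ _) (half-even n) (⌊n/2⌋-mono h)

≤-half : ∀ {n} N → n ≤ ⌊ N /2⌋ → 2 * n ≤ N
≤-half {n} N h = ≤-trans (*-monoʳ-≤ 2 h) (≤-trans
  (+-monoʳ-≤ ⌊ N /2⌋ (≤-trans (≤-reflexive (+-identityʳ _)) (⌊n/2⌋≤⌈n/2⌉ N)))
  (≤-reflexive (⌊n/2⌋+⌈n/2⌉≡n N)))

count-zeroWeight : ∀ k d → count (suc k) d 0 ≡ 1
count-zeroWeight k zero    = count-zeroDegree (suc k) 0
count-zeroWeight k (suc d) = trans (+-identityʳ _) (count-zeroWeight k d)

-- The corresponding kernel element is x₀^d; multiplying by it raises the degree without changing
-- the weight.
ascent-zeroWeight : ∀ k d → Ascent (suc k) d 0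
ascent-zeroWeight k d = ≤-reflexive (sym (count-zeroWeight k d))

-- Induction in steps of 8

half8 : ∀ ℓ → 2 * (4 * ℓ) ≡ ℓ * 8
half8 = ℕSolver.solve-∀

-- A weight n in the lower half for (ℓ, 8 + m) is the sum of admissible weights for (ℓ, 8) and (ℓ, m); weight 1 being
-- inadmissible, n = 4ℓ + 1 must be split as (4ℓ - 1) + 2.
ascending-+8 : ∀ {ℓ m} → 1 ≤ ℓ → 4 ≤ m → Ascending ℓ 8 → Ascending ℓ m → Ascending ℓ (8 + m)
ascending-+8 {ℓ@(suc ℓ′)} {m} _ 4≤m asc8 asc n 2≤n bound with n ≤? 4 * ℓ
... | yes n≤4ℓ = subst (Ascent (suc ℓ) (8 + m)) (+-identityʳ n)
  (ascent-+ {d = 8} {m} {n} {0} (asc8 n 2≤n (≤-trans (*-monoʳ-≤ 2 n≤4ℓ) (≤-reflexive (half8 ℓ)))) (ascent-zeroWeight ℓ m)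
    (≤-trans (≤-trans (n≤1+n 1) 2≤n) (m≤m+n n 0)) (subst (λ z → 2 * z ≤ ℓ * (8 + m)) (sym (+-identityʳ n)) bound))
... | no n≰4ℓ = above (n ∸ 4 * ℓ) (sym (m+[n∸m]≡n (<⇒≤ (≰⇒> n≰4ℓ))))
  where
  2≤4ℓ-1 : 2 ≤ 3 + 4 * ℓ′
  2≤4ℓ-1 = s≤s (s≤s z≤n)
  predecessor : ∀ ℓ′ → 4 * suc ℓ′ ≡ suc (3 + 4 * ℓ′)
  predecessor = ℕSolver.solve-∀
  regroup : ∀ ℓ′ → 3 + 4 * ℓ′ + 2 ≡ 4 * suc ℓ′ + 1
  regroup = ℕSolver.solve-∀
  distribute : ∀ ℓ r → 2 * (4 * ℓ + r) ≡ ℓ * 8 + 2 * r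
  distribute = ℕSolver.solve-∀
  above : ∀ r → n ≡ 4 * ℓ + r → Ascent (suc ℓ) (8 + m) n
  above zero          eq = ⊥-elim (n≰4ℓ (≤-reflexive (trans eq (+-identityʳ _))))
  above (suc zero)    eq = subst (Ascent (suc ℓ) (8 + m)) (sym eq′)
    (ascent-+ {d = 8} {m} {3 + 4 * ℓ′} {2}
      (asc8 (3 + 4 * ℓ′) 2≤4ℓ-1 (≤-trans (*-monoʳ-≤ 2 (≤-trans (n≤1+n _) (≤-reflexive (sym (predecessor ℓ′))))) (≤-reflexive (half8 ℓ))))
      (asc 2 ≤-refl (*-mono-≤ {1} {ℓ} (s≤s z≤n) 4≤m))
      (s≤s z≤n) (subst (λ z → 2 * z ≤ ℓ * (8 + m)) eq′ bound))
    where
    eq′ : n ≡ 3 + 4 * ℓ′ + 2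
    eq′ = trans eq (sym (regroup ℓ′))
  above (suc (suc r)) refl = ascent-+ {d = 8} {m} {4 * ℓ} {2 + r}
    (asc8 (4 * ℓ) (≤-trans (≤-trans 2≤4ℓ-1 (n≤1+n _)) (≤-reflexive (sym (predecessor ℓ′)))) (≤-reflexive (half8 ℓ)))
    (asc (2 + r) (s≤s (s≤s z≤n)) (+-cancelˡ-≤ (ℓ * 8) _ _
      (subst₂ _≤_ (distribute ℓ (2 + r)) (*-distribˡ-+ ℓ 8 m) bound)))
    (≤-trans (s≤s z≤n) 2≤n) bound

-- Eight consecutive values of `m` suffice as a base. The condition `4 ≤ s` leaves room for weight 2
-- in the lower half of the smaller rectangle, as the splitting in `ascending-+8` demands.
ascending-period : ∀ {ℓ} s → 1 ≤ ℓ → 4 ≤ s → Ascending ℓ 8 → (∀ m → s ≤ m → m < 8 + s → Ascending ℓ m) →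
  ∀ m → s ≤ m → Ascending ℓ m
ascending-period {ℓ} s 1≤ℓ 4≤s asc8 base = <-rec _ step
  where
  step : ∀ m → (∀ {m′} → m′ < m → s ≤ m′ → Ascending ℓ m′) → s ≤ m → Ascending ℓ m
  step m rec s≤m with m <? 8 + s
  ... | yes m<8+s = base m s≤m m<8+s
  ... | no m≮8+s  = subst (Ascending ℓ) (m+[n∸m]≡n 8≤m)
    (ascending-+8 1≤ℓ (≤-trans 4≤s s≤m-8) asc8 (rec (∸-monoʳ-< (s≤s z≤n) 8≤m) s≤m-8))
    where
    8+s≤m = ≮⇒≥ m≮8+s
    8≤m : 8 ≤ m
    8≤m = ≤-trans (m≤m+n 8 s) 8+s≤m
    s≤m-8 : s ≤ m ∸ 8
    s≤m-8 = +-cancelˡ-≤ 8 _ _ (≤-trans 8+s≤m (≤-reflexive (sym (m+[n∸m]≡n 8≤m))))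

ascending-transpose : ∀ {ℓ m} → Ascending ℓ m → Ascending m ℓ
ascending-transpose {ℓ} {m} asc (suc n) 2≤n bound =
  subst₂ _<_ (count-transpose ℓ m n) (count-transpose ℓ m (suc n)) (asc (suc n) 2≤n (subst (2 * suc n ≤_) (*-comm m ℓ) bound))

rises⇒ascending : ∀ ℓ m → Rises (ℓ * m) (gaussian ℓ m) → Ascending ℓ m
rises⇒ascending ℓ m rises (suc n) 2≤n bound =
  subst₂ _<_ (gaussian-correct ℓ m n) (gaussian-correct ℓ m (suc n)) (rises (s≤s (half-≤ bound)) 2≤n)

exceptional-bounds : ∀ {ℓ} → ℓ < 8 → All (λ m → m < 15 × m ≢ 8) (exceptional ℓ)
exceptional-bounds = toWitness {a? = allUpTo? (λ ℓ → All.all? (λ m → (m <? 15) ×-dec ¬? (m ≟ 8)) (exceptional ℓ)) 8} tt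

ascending-narrow : ∀ ℓ m → 5 ≤ ℓ → ℓ < 8 → ℓ ≤ m → m ∉ exceptional ℓ → Ascending ℓ m
ascending-narrow ℓ m 5≤ℓ ℓ<8 ℓ≤m m∉ with m <? 23
... | yes m<23 = rises⇒ascending ℓ m (narrow-rises ℓ<8 5≤ℓ m<23 ℓ≤m m∉)
... | no m≮23  = ascending-period 15 (≤-trans (s≤s z≤n) 5≤ℓ) (m≤m+n 4 11)
  (rises⇒ascending ℓ 8 (narrow-rises ℓ<8 5≤ℓ (m≤m+n 9 14) (<⇒≤ ℓ<8) λ 8∈ → proj₂ (All.lookup (exceptional-bounds ℓ<8) 8∈) refl))
  (λ m′ 15≤m′ m′<23 → rises⇒ascending ℓ m′ (narrow-rises ℓ<8 5≤ℓ m′<23 (≤-trans (<⇒≤ ℓ<8) (≤-trans (m≤m+n 8 7) 15≤m′))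
    λ m′∈ → <⇒≱ (proj₁ (All.lookup (exceptional-bounds ℓ<8) m′∈)) 15≤m′))
  m (≤-trans (m≤m+n 15 8) (≮⇒≥ m≮23))

-- The periodicity is used twice: after transposition it extends `ℓ` for each m = 8, ..., 15, and
-- then it extends `m` for the given `ℓ`.
ascending-wide : ∀ ℓ m → 8 ≤ ℓ → 8 ≤ m → Ascending ℓ m
ascending-wide ℓ m 8≤ℓ = ascending-period 8 (≤-trans (s≤s z≤n) 8≤ℓ) (m≤m+n 4 4)
  (strip 8 ≤-refl (m≤m+n 9 7)) strip m
  where
  small : ∀ ℓ m → 8 ≤ ℓ → ℓ < 16 → 8 ≤ m → m < 16 → Ascending ℓ m
  small ℓ m 8≤ℓ ℓ<16 8≤m m<16 = rises⇒ascending ℓ m (wide-rises ℓ<16 8≤ℓ m<16 8≤m)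
  strip : ∀ m → 8 ≤ m → m < 16 → Ascending ℓ m
  strip m 8≤m m<16 = ascending-transpose {m} {ℓ} (ascending-period 8 (≤-trans (s≤s z≤n) 8≤m) (m≤m+n 4 4)
    (small m 8 8≤m m<16 ≤-refl (m≤m+n 9 7)) (λ ℓ 8≤ℓ ℓ<16 → small m ℓ 8≤m m<16 8≤ℓ ℓ<16) ℓ 8≤ℓ)

-- Strict unimodality of the partition numbers and its failures

ascending⇒unimodal : ∀ ℓ m → Ascending ℓ m → StrictlyUnimodal ℓ m
ascending⇒unimodal ℓ m asc = up , middle , down
  where
  N = ℓ * m
  asc′ : ∀ i → 1 ≤ i → 2 * suc i ≤ N → p i ℓ m < p (suc i) ℓ m
  asc′ i 1≤i h = subst₂ _<_ (sym (boxPart≡count ℓ m i)) (sym (boxPart≡count ℓ m (suc i))) (asc (suc i) (s≤s 1≤i) h)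
  reflect : ∀ a b → a + b ≡ N → p a ℓ m ≡ p b ℓ m
  reflect a b eq = trans (boxPart≡count ℓ m a) (trans (count-reflect ℓ m a b eq) (sym (boxPart≡count ℓ m b)))
  up : ∀ i → 1 ≤ i → i < ⌊ N /2⌋ → p i ℓ m < p (suc i) ℓ m
  up i 1≤i i< = asc′ i 1≤i (≤-half N i<)
  middle : p ⌊ N /2⌋ ℓ m ≡ p ⌈ N /2⌉ ℓ m
  middle = reflect ⌊ N /2⌋ ⌈ N /2⌉ (⌊n/2⌋+⌈n/2⌉≡n N)
  down : ∀ i → ⌈ N /2⌉ ≤ i → suc i ≤ N ∸ 1 → p i ℓ m > p (suc i) ℓ m
  down i ⌈N/2⌉≤i 1+i≤N-1 = subst₂ _<_ (reflect j (suc i) (m∸n+n≡m 1+i≤N))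
    (reflect (suc j) i (trans (sym (+-suc j i)) (m∸n+n≡m 1+i≤N)))
    (asc′ j 1≤j (≤-half N (+-cancelʳ-≤ ⌈ N /2⌉ (suc j) ⌊ N /2⌋ (begin
      suc j + ⌈ N /2⌉       ≤⟨ +-monoʳ-≤ (suc j) ⌈N/2⌉≤i ⟩
      suc j + i             ≡⟨ sym (+-suc j i) ⟩
      j + suc i             ≡⟨ m∸n+n≡m 1+i≤N ⟩
      N                     ≡⟨ sym (⌊n/2⌋+⌈n/2⌉≡n N) ⟩
      ⌊ N /2⌋ + ⌈ N /2⌉     ∎))))
    where
    open ≤-Reasoning
    -- The descent from `i` to `suc i` mirrors the ascent from `j` to `suc j`; stopping at N - 1
    -- makes j ≥ 1, which avoids the equality p₀ = p₁.
    j = N ∸ suc i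
    1+i≤N : suc i ≤ N
    1+i≤N = ≤-trans 1+i≤N-1 (m∸n≤m N 1)
    1≤j : 1 ≤ j
    1≤j = m<n⇒0<n∸m (≤-trans (s≤s 1+i≤N-1) (≤-reflexive (m+[n∸m]≡n (≤-trans (s≤s z≤n) 1+i≤N))))

stationary⇒¬unimodal : ∀ ℓ m i → 1 ≤ i → 2 * suc i ≤ ℓ * m → Stationary ℓ m i → ¬ StrictlyUnimodal ℓ m
stationary⇒¬unimodal ℓ m i 1≤i h eq (up , _) =
  <-irrefl (trans (boxPart≡count ℓ m i) (trans (sym eq) (sym (boxPart≡count ℓ m (suc i))))) (up i 1≤i (half-≤ h))

¬rises⇒¬unimodal : ∀ ℓ m → {False (rises? (ℓ * m) (gaussian ℓ m))} → ¬ StrictlyUnimodal ℓ m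
¬rises⇒¬unimodal ℓ m {fails} (up , _) = toWitnessFalse fails rises
  where
  rises : Rises (ℓ * m) (gaussian ℓ m)
  rises {suc n} (s≤s h) (s≤s 1≤n) = subst₂ _<_
    (trans (boxPart≡count ℓ m n) (sym (gaussian-correct ℓ m n)))
    (trans (boxPart≡count ℓ m (suc n)) (sym (gaussian-correct ℓ m (suc n)))) (up n 1≤n h)

¬unimodal-2 : ∀ m → 3 ≤ m → ¬ StrictlyUnimodal 2 m
¬unimodal-2 m 3≤m = stationary⇒¬unimodal 2 m 2 (s≤s z≤n) (*-monoʳ-≤ 2 3≤m) (stationary-2 m 3≤m)

¬unimodal-4 : ∀ m → 4 ≤ m → ¬ StrictlyUnimodal 4 m
¬unimodal-4 (suc j) (s≤s 3≤j) = stationary⇒¬unimodal 4 (suc j) (2 * j)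
  (≤-trans (s≤s z≤n) (*-monoʳ-≤ 2 3≤j)) (≤-trans (m≤m+n _ 2) (≤-reflexive (total j))) (stationary-4 j)
  where
  total : ∀ j → 2 * suc (2 * j) + 2 ≡ 4 * suc j
  total = ℕSolver.solve-∀

evenOrOdd : ∀ n → (Σ[ i ∈ ℕ ] n ≡ 2 * i) ⊎ (Σ[ i ∈ ℕ ] n ≡ 1 + 2 * i)
evenOrOdd zero    = inj₁ (0 , refl)
evenOrOdd (suc n) = [ (λ { (i , eq) → inj₂ (i , cong suc eq) }) , (λ { (i , eq) → inj₁ (suc i , trans (cong suc eq) (next i)) }) ]′ (evenOrOdd n)
  where
  next : ∀ i → 2 + 2 * i ≡ 2 * suc i
  next = ℕSolver.solve-∀

¬unimodal-3 : ∀ m → 3 ≤ m → ¬ StrictlyUnimodal 3 m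
¬unimodal-3 m 3≤m u with evenOrOdd m
... | inj₂ (zero , refl) = case 3≤m of λ { (s≤s ()) }
... | inj₂ (suc j , refl) = stationary⇒¬unimodal 3 (1 + 2 * suc j) (3 * suc j) (s≤s z≤n)
    (≤-trans (m≤m+n _ 1) (≤-reflexive (total (suc j)))) (stationary-3-odd (suc j)) u
  where
  total : ∀ j → 2 * suc (3 * j) + 1 ≡ 3 * (1 + 2 * j)
  total = ℕSolver.solve-∀
... | inj₁ (i , refl) with evenOrOdd i
... | inj₂ (i′ , refl) = stationary⇒¬unimodal 3 (2 + 2 * (2 * i′)) (2 + 3 * (2 * i′)) (s≤s z≤n)
    (≤-reflexive (total (2 * i′))) (stationary-3-2mod4 i′) (subst (StrictlyUnimodal 3) (residue (2 * i′)) u)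
  where
  total : ∀ j → 2 * suc (2 + 3 * j) ≡ 3 * (2 + 2 * j)
  total = ℕSolver.solve-∀
  residue : ∀ j → 2 * (1 + j) ≡ 2 + 2 * j
  residue = ℕSolver.solve-∀
... | inj₁ (zero , refl) = case 3≤m of λ ()
... | inj₁ (suc i′ , refl) = stationary⇒¬unimodal 3 (4 + 2 * (2 * i′)) (4 + 3 * (2 * i′)) (s≤s z≤n)
    (≤-trans (m≤m+n _ 2) (≤-reflexive (total (2 * i′)))) (stationary-3-0mod4 i′) (subst (StrictlyUnimodal 3) (residue i′) u)
  where
  total : ∀ j → 2 * suc (4 + 3 * j) + 2 ≡ 3 * (4 + 2 * j)
  total = ℕSolver.solve-∀
  residue : ∀ i → 2 * (2 * suc i) ≡ 4 + 2 * (2 * i)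
  residue = ℕSolver.solve-∀

NotExceptional : ℕ → ℕ → Set
NotExceptional ℓ m =
  ¬ (ℓ ≡ 5 × m ≡ 6) × ¬ (ℓ ≡ 5 × m ≡ 10) × ¬ (ℓ ≡ 5 × m ≡ 14) ×
  ¬ (ℓ ≡ 6 × m ≡ 6) × ¬ (ℓ ≡ 6 × m ≡ 7) × ¬ (ℓ ≡ 6 × m ≡ 9) ×
  ¬ (ℓ ≡ 6 × m ≡ 11) × ¬ (ℓ ≡ 6 × m ≡ 13) × ¬ (ℓ ≡ 7 × m ≡ 10)

notExceptional⇒∉ : ∀ ℓ {m} → NotExceptional ℓ m → m ∉ exceptional ℓ
notExceptional⇒∉ 5 (a , _) (here refl) = a (refl , refl)
notExceptional⇒∉ 5 (_ , a , _) (there (here refl)) = a (refl , refl)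
notExceptional⇒∉ 5 (_ , _ , a , _) (there (there (here refl))) = a (refl , refl)
notExceptional⇒∉ 6 (_ , _ , _ , a , _) (here refl) = a (refl , refl)
notExceptional⇒∉ 6 (_ , _ , _ , _ , a , _) (there (here refl)) = a (refl , refl)
notExceptional⇒∉ 6 (_ , _ , _ , _ , _ , a , _) (there (there (here refl))) = a (refl , refl)
notExceptional⇒∉ 6 (_ , _ , _ , _ , _ , _ , a , _) (there (there (there (here refl)))) = a (refl , refl)
notExceptional⇒∉ 6 (_ , _ , _ , _ , _ , _ , _ , a , _) (there (there (there (there (here refl))))) = a (refl , refl)
notExceptional⇒∉ 7 (_ , _ , _ , _ , _ , _ , _ , _ , a) (here refl) = a (refl , refl)

theorem2p1 : (ℓ m : ℕ) → 2 ≤ ℓ → 2 ≤ m → ℓ ≤ m →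
    (StrictlyUnimodal ℓ m ⇔
    ((ℓ ≡ 2 × m ≡ 2) ⊎
    (5 ≤ ℓ × 5 ≤ m ×
    ¬ (ℓ ≡ 5 × m ≡ 6) × ¬ (ℓ ≡ 5 × m ≡ 10) × ¬ (ℓ ≡ 5 × m ≡ 14) ×
    ¬ (ℓ ≡ 6 × m ≡ 6) × ¬ (ℓ ≡ 6 × m ≡ 7) × ¬ (ℓ ≡ 6 × m ≡ 9) ×
    ¬ (ℓ ≡ 6 × m ≡ 11) × ¬ (ℓ ≡ 6 × m ≡ 13) × ¬ (ℓ ≡ 7 × m ≡ 10))))
theorem2p1 ℓ m 2≤ℓ 2≤m ℓ≤m = mk⇔ (necessary ℓ 2≤ℓ ℓ≤m) sufficient
  where
  necessary : ∀ ℓ → 2 ≤ ℓ → ℓ ≤ m → StrictlyUnimodal ℓ m → (ℓ ≡ 2 × m ≡ 2) ⊎ (5 ≤ ℓ × 5 ≤ m × NotExceptional ℓ m)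
  necessary 1 (s≤s ())
  necessary 2 _ 2≤m u with m ≟ 2
  ... | yes m≡2 = inj₁ (refl , m≡2)
  ... | no m≢2  = ⊥-elim (¬unimodal-2 m (≤∧≢⇒< 2≤m (m≢2 ∘ sym)) u)
  necessary 3 _ 3≤m u = ⊥-elim (¬unimodal-3 m 3≤m u)
  necessary 4 _ 4≤m u = ⊥-elim (¬unimodal-4 m 4≤m u)
  necessary ℓ@(suc (suc (suc (suc (suc _))))) _ ℓ≤m u = inj₂
    ( 5≤ℓ , ≤-trans 5≤ℓ ℓ≤m
    , (λ { (refl , refl) → ¬rises⇒¬unimodal 5 6 u }) , (λ { (refl , refl) → ¬rises⇒¬unimodal 5 10 u })
    , (λ { (refl , refl) → ¬rises⇒¬unimodal 5 14 u }) , (λ { (refl , refl) → ¬rises⇒¬unimodal 6 6 u })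
    , (λ { (refl , refl) → ¬rises⇒¬unimodal 6 7 u }) , (λ { (refl , refl) → ¬rises⇒¬unimodal 6 9 u })
    , (λ { (refl , refl) → ¬rises⇒¬unimodal 6 11 u }) , (λ { (refl , refl) → ¬rises⇒¬unimodal 6 13 u })
    , (λ { (refl , refl) → ¬rises⇒¬unimodal 7 10 u }))
    where
    5≤ℓ : 5 ≤ ℓ
    5≤ℓ = m≤m+n 5 _

  sufficient : (ℓ ≡ 2 × m ≡ 2) ⊎ (5 ≤ ℓ × 5 ≤ m × NotExceptional ℓ m) → StrictlyUnimodal ℓ m
  sufficient (inj₁ (refl , refl)) = ascending⇒unimodal 2 2
    (rises⇒ascending 2 2 (toWitness {a? = rises? 4 (gaussian 2 2)} tt))
  sufficient (inj₂ (5≤ℓ , _ , exceptions)) with ℓ <? 8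
  ... | yes ℓ<8 = ascending⇒unimodal ℓ m (ascending-narrow ℓ m 5≤ℓ ℓ<8 ℓ≤m (notExceptional⇒∉ ℓ exceptions))
  ... | no ℓ≮8  = ascending⇒unimodal ℓ m (ascending-wide ℓ m 8≤ℓ (≤-trans 8≤ℓ ℓ≤m))
    where
    8≤ℓ : 8 ≤ ℓ
    8≤ℓ = ≮⇒≥ ℓ≮8
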